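{- Simple type theory, i.e. the following theory of the $\lambda\Pi$-calculus modulo theory (for any finite set of simple types $A$ for which a quantifier $\forall_A$ is declared), is super-consistent. Constants: $$\iota:Type,\quad o:Type,\quad {\Rightarrow}:o\to o\to o,\quad \forall_A:(A\to o)\to o,\quad \varepsilon:o\to Type;$$ rewrite rules: $$(\varepsilon\,({\Rightarrow}\,x\,y))\longrightarrow(\varepsilon\,x)\to(\varepsilon\,y),\qquad (\varepsilon\,(\forall_A\,x))\longrightarrow\Pi z:A\;(\varepsilon\,(x\,z)),$$ in the rule contexts $x:o,\,y:o$ and $x:A\to o$ respectively, where simple types are the types built from $\iota$ and $o$ with $\to$.
   Context: **Terms.** Terms are $t ::= x\mid Type\mid Kind\mid \Pi x:t\;t\mid\lambda x:t\;t\mid t\,t$, up to $\alpha$-equivalence; $(u/x)t$ is capture-avoiding substitution; $A\to B$ is $\Pi x:A\;B$ with $x$ not free in $B$. $\beta$ is root $\beta$-reduction. For a relation $r$ on terms, $\longrightarrow^1_r$ is its closure under term formation, $\longrightarrow^*_r$ the reflexive-transitive closure of $\longrightarrow_r^1$, and $\equiv_r$ its reflexive-symmetric-transitive closure. **Theories.** A rewrite rule is a triple $l\longrightarrow^{\Gamma}r$ with $\Gamma$ a context and $l,r$ $\beta$-normal; it is well-typed in a context $\Sigma$ if, in the $\lambda\Pi$-calculus, $\Sigma,\Gamma$ is well-formed and $l,r$ have a common type $A$ in $\Sigma,\Gamma$. A theory $\Sigma,\mathcal R$ is a context $\Sigma$ well-formed in the $\lambda\Pi$-calculus (its variables are called constants)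 and a set $\mathcal R$ of rewrite rules well-typed in $\Sigma$. $t\,\mathcal R\,u$ (root reduction) means $t=\theta l$, $u=\theta r$ for some rule $l\longrightarrow^\Gamma r$ and substitution $\theta$ of the variables of $\Gamma$. $\beta\mathcal R$ is the union of $\beta$ and $\mathcal R$. **Typing in the $\lambda\Pi$-calculus modulo $\Sigma,\mathcal R$.** (Empty) $[\,]$ is well-formed. (Declaration) if $\Gamma\vdash A:Type$ or $\Gamma\vdash A:Kind$, and $x\notin\Sigma,\Gamma$, then $\Gamma,x:A$ is well-formed. (Sort) if $\Gamma$ is well-formed, $\Gamma\vdash Type:Kind$. (Variable) if $\Gamma$ is well-formed and $x:A\in\Sigma,\Gamma$ then $\Gamma\vdash x:A$. For $s\in\{Type,Kind\}$: (Product) if $\Gamma\vdash A:Type$ and $\Gamma,x:A\vdash B:s$ then $\Gamma\vdash\Pi x:A\;B:s$; (Abstraction) if moreover $\Gamma,x:A\vdash t:B$ then $\Gamma\vdash\lambda x:A\;t:\Pi x:A\;B$. (Application) if $\Gamma\vdash t:\Pi x:A\;B$ and $\Gamma\vdash u:A$ then $\Gamma\vdash(t\,u):(u/x)B$. (Conversion) for $s\in\{Type,Kind\}$, if $\Gamma\vdash A:s$, $\Gamma\vdash B:s$, $\Gamma\vdash t:A$ and $A\equiv_{\beta\mathcal R}B$ then $\Gamma\vdash t:B$. The plain $\lambda\Pi$-calculus is the case where $\Sigma$ and $\mathcal R$ are empty. Throughout, $\longrightarrow^1_{\beta\mathcal R}$ is assumed confluent and to have the subject reduction property. **$\Pi$-algebras.**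 A $\Pi$-algebra is a set $\mathcal B$ with a pre-order $\le$, an element $\tilde\top$, a function $\tilde\wedge:\mathcal B\times\mathcal B\to\mathcal B$, a subset $\mathcal A$ of the set $\mathcal P^+(\mathcal B)$ of non-empty subsets of $\mathcal B$, and a function $\tilde\Pi:\mathcal B\times\mathcal A\to\mathcal B$, such that $a\le\tilde\top$ for all $a$; $a\,\tilde\wedge\,b$ is a greatest lower bound of $\{a,b\}$; and $a\le\tilde\Pi(b,S)$ iff $a\,\tilde\wedge\,b\le c$ for all $c\in S$. It is full if $\mathcal A=\mathcal P^+(\mathcal B)$. It is ordered if equipped with an order relation $\sqsubseteq$ on $\mathcal B$ such that $a\sqsubseteq b$ implies $\tilde\Pi(b,S)\sqsubseteq\tilde\Pi(a,S)$ for all $S$, and $S\sqsubseteq T$ implies $\tilde\Pi(a,S)\sqsubseteq\tilde\Pi(a,T)$ for all $a$, where $S\sqsubseteq T$ means that for all $a\in S$ there is $b\in T$ with $a\sqsubseteq b$. An ordered $\Pi$-algebra is complete if every subset of $\mathcal B$ has a least upper bound for $\sqsubseteq$. **Models.** A model is a family $\mathcal D^1,\dots,\mathcal D^n$ ($n\ge2$) of functions. $\mathcal D^i$ maps each term $t$ of type $B$ in some context $\Gamma$ (in the calculus modulo $\Sigma,\mathcal R$), and valuations $\phi_1,\dots,\phi_{i-1}$, where $\phi_j$ maps each $x:A$ of $\Gamma$ to an element of $\mathcal D^j_{A,\phi_1,\dots,\phi_{j-1}}$, to some $\mathcal D^i_{t,\phi_1,\dots,\phi_{i-1}}$, which for $i\ge2$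 lies in $\mathcal D^{i-1}_{B,\phi_1,\dots,\phi_{i-2}}$; the functions are also defined on $Kind$ (without membership condition). The value depends only on $t$ and on the values of the valuations on variables free in $t$. Write $\llbracket t\rrbracket_{\phi_1,\dots,\phi_{n-1}}$ for $\mathcal D^n_{t,\phi_1,\dots,\phi_{n-1}}$. It is required that, for all $t,u$ and valuations (with $u$ of the declared type of $x$), $$\llbracket(u/x)t\rrbracket_{\phi_1,\dots,\phi_{n-1}}=\llbracket t\rrbracket_{(\phi_1,x=\mathcal D^1_u),\dots,(\phi_{n-1},x=\mathcal D^{n-1}_{u,\phi_1,\dots,\phi_{n-2}})}.$$ The model is valued in $\mathcal B$ if $\mathcal D^{n-1}_{Kind,\phi_1,\dots,\phi_{n-2}}=\mathcal D^{n-1}_{Type,\phi_1,\dots,\phi_{n-2}}=\mathcal B$, $\llbracket Kind\rrbracket_{\overline\phi}=\llbracket Type\rrbracket_{\overline\phi}=\tilde\top$, and $$\llbracket\Pi x:C\;D\rrbracket_{\overline\phi}=\tilde\Pi(\llbracket C\rrbracket_{\overline\phi},\{\llbracket D\rrbracket_{(\phi_1,x=c_1),\dots,(\phi_{n-1},x=c_{n-1})}\mid c_1\in\mathcal D^1_C,\dots,c_{n-1}\in\mathcal D^{n-1}_{C,\phi_1,\dots,\phi_{n-2}}\}).$$ A model valued in $\mathcal B$ is a model of $\Sigma,\mathcal R$ if $\llbracket A\rrbracket\ge\tilde\top$ for every constant $c:A$ in $\Sigma$, and for all $A,B$ well-typed in a context $\Gamma$ with $A\equiv_{\beta\mathcal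 R}B$, all $i$ and all valuations $\overline\phi$, $\mathcal D^i_{A,\overline\phi}=\mathcal D^i_{B,\overline\phi}$. **Super-consistency.** A theory $\Sigma,\mathcal R$ is super-consistent if, for every full, ordered and complete $\Pi$-algebra $\mathcal B$, there exists a model of $\Sigma,\mathcal R$ valued in $\mathcal B$.
   Formalization: In the substitution condition on models, x receives the value D^{j+1} of u in the j-th valuation instead of the printed D^j of u, which need not lie in D^j_A and leaves the right side undefined; the condition is required only where the resulting valuations are legitimate. -}

module Defs where

open import Level using (0ℓ) renaming (suc to lsuc)
open import Data.Nat using (ℕ; zero; suc; _+_; _<_)
open import Data.Fin using (Fin; zero; suc; _↑ˡ_; _↑ʳ_)
open import Data.Fin.Patterns using (0F; 1F; 2F)
open import Data.Vec using (Vec; []; _∷_)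
open import Data.Vec.Functional using (Vector; insertAt)
open import Data.Vec.Relation.Binary.Pointwise.Inductive using (Pointwise)
open import Data.List using (List; []; _∷_; length)
open import Data.List.Membership.Propositional using () renaming (_∈_ to _∈ₗ_)
open import Data.List.Relation.Unary.Any using (here; there; index)
open import Data.Product using (∃; _×_; _,_; proj₁; proj₂)
open import Data.Unit using (⊤)
open import Data.Empty using (⊥)
open import Function.Base using (_on_)
open import Function.Bundles using (_⇔_)
open import Function.Definitions using (Injective)
open import Relation.Unary using (Pred)
open import Relation.Binary.Core using (Rel)
open import Relation.Binary.Structures using (IsPreorder; IsPartialOrder)
open import Relation.Binary.Definitions using (Maximum)
open import Relation.Binary.Lattice.Definitions using (Infimum)
open import Relation.Binary.Construct.Union using (_∪_)
open import Relation.Binary.Construct.Closure.Equivalence using (EqClosure)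
open import Relation.Binary.Rewriting using (IsNormalForm)
  renaming (Confluent to ConfluentRel)
open import Relation.Binary.PropositionalEquality
  using (_≡_; refl; sym; trans; cong; cong₂; subst)

-- The interpretations D¹, …, Dⁿ⁻¹ take sets as values, whose elements may
-- again be used as sets, so they are stated in a universe of (well-founded,
-- iterative) sets with extensional equality, rather than in types.

data V : Set₁ where
  sup : (I : Set) → (I → V) → V

Index : V → Set
Index (sup I _) = I

elem : (x : V) → Index x → V
elem (sup _ f) = f

infix 4 _≐_ _∈_ _⊆_

_≐_ : V → V → Set
sup I f ≐ sup J g =
  (∀ i → ∃ λ j → f i ≐ g j) × (∀ j → ∃ λ i → f i ≐ g j)

_∈_ : V → V → Set
x ∈ y = ∃ λ (j : Index y) → x ≐ elem y j

_⊆_ : V → V → Set₁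
x ⊆ y = ∀ {z} → z ∈ x → z ∈ y

Inhabited : V → Set₁
Inhabited x = ∃ λ z → z ∈ x

record Element (b : V) : Set₁ where
  constructor ⟨_,_⟩
  field
    value  : V
    value∈ : value ∈ b

open Element

_≈_ : {b : V} → Rel (Element b) 0ℓ
_≈_ = _≐_ on value

record ΠAlgebra : Set₂ where
  infix 4 _≤_
  field
    𝓑          : V
    _≤_        : Rel (Element 𝓑) 0ℓ
    isPreorder : IsPreorder _≈_ _≤_
    ⊤̃          : Element 𝓑
    maximum    : Maximum _≤_ ⊤̃
    _∧̃_        : Element 𝓑 → Element 𝓑 → Element 𝓑
    ∧̃-cong     : ∀ {a a′ b b′} → a ≈ a′ → b ≈ b′ → (a ∧̃ b) ≈ (a′ ∧̃ b′)
    infimum    : Infimum _≤_ _∧̃_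
    𝓐          : Pred V (lsuc 0ℓ)
    𝓐-resp     : ∀ {S T} → S ≐ T → 𝓐 S → 𝓐 T
    𝓐-subset   : ∀ {S} → 𝓐 S → S ⊆ 𝓑
    𝓐-nonempty : ∀ {S} → 𝓐 S → Inhabited S
    Π̃          : Element 𝓑 → ∃ 𝓐 → Element 𝓑
    Π̃-cong     : ∀ {a b} {S T : ∃ 𝓐} →
                 a ≈ b → proj₁ S ≐ proj₁ T → Π̃ a S ≈ Π̃ b T
    Π̃-adjoint  : ∀ a b (S : ∃ 𝓐) →
                 (a ≤ Π̃ b S) ⇔
                 (∀ (c : Element 𝓑) → value c ∈ proj₁ S → (a ∧̃ b) ≤ c)

Full : ΠAlgebra → Set₁
Full B = ∀ {S} → S ⊆ 𝓑 → Inhabited S → 𝓐 S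
  where open ΠAlgebra B

record Ordering (B : ΠAlgebra) : Set₁ where
  open ΠAlgebra B
  infix 4 _⊑_ _⊑ₛ_
  field
    _⊑_            : Rel (Element 𝓑) 0ℓ
    isPartialOrder : IsPartialOrder _≈_ _⊑_

  _⊑ₛ_ : V → V → Set₁
  S ⊑ₛ T = ∀ (a : Element 𝓑) → value a ∈ S →
           ∃ λ (b : Element 𝓑) → value b ∈ T × a ⊑ b

  field
    Π̃-antitone : ∀ {a b} (S : ∃ 𝓐) → a ⊑ b → Π̃ b S ⊑ Π̃ a S
    Π̃-monotone : ∀ a {S T : ∃ 𝓐} → proj₁ S ⊑ₛ proj₁ T → Π̃ a S ⊑ Π̃ a T

Complete : {B : ΠAlgebra} → Ordering B → Set₁
Complete {B} O = ∀ S → S ⊆ 𝓑 → ∃ λ (m : Element 𝓑) →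
    UpperBound S m × (∀ m′ → UpperBound S m′ → m ⊑ m′)
  where
  open ΠAlgebra B
  open Ordering O

  UpperBound : V → Element 𝓑 → Set₁
  UpperBound S m = ∀ (a : Element 𝓑) → value a ∈ S → a ⊑ m

data Sort : Set where
  Type Kind : Sort

infixl 9 _·_

data Term (n : ℕ) : Set where
  var  : Fin n → Term n
  sort : Sort → Term n
  Π    : Term n → Term (suc n) → Term n
  ƛ    : Term n → Term (suc n) → Term n
  _·_  : Term n → Term n → Term n

TermRel : Set₁
TermRel = ∀ {n} → Rel (Term n) 0ℓ

liftᵣ : ∀ {m n} → (Fin m → Fin n) → Fin (suc m) → Fin (suc n)
liftᵣ ρ zero    = zero
liftᵣ ρ (suc x) = suc (ρ x)

rename : ∀ {m n} → (Fin m → Fin n) → Term m → Term n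
rename ρ (var x)  = var (ρ x)
rename ρ (sort s) = sort s
rename ρ (Π A B)  = Π (rename ρ A) (rename (liftᵣ ρ) B)
rename ρ (ƛ A t)  = ƛ (rename ρ A) (rename (liftᵣ ρ) t)
rename ρ (t · u)  = rename ρ t · rename ρ u

weaken : ∀ {n} → Term n → Term (suc n)
weaken = rename suc

liftₛ : ∀ {m n} → (Fin m → Term n) → Fin (suc m) → Term (suc n)
liftₛ σ zero    = var zero
liftₛ σ (suc x) = weaken (σ x)

infixl 8 _⟪_⟫ _[_≔_] _[_]

_⟪_⟫ : ∀ {m n} → Term m → (Fin m → Term n) → Term n
var x   ⟪ σ ⟫ = σ x
sort s  ⟪ σ ⟫ = sort s
Π A B   ⟪ σ ⟫ = Π (A ⟪ σ ⟫) (B ⟪ liftₛ σ ⟫)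
ƛ A t   ⟪ σ ⟫ = ƛ (A ⟪ σ ⟫) (t ⟪ liftₛ σ ⟫)
(t · u) ⟪ σ ⟫ = (t ⟪ σ ⟫) · (u ⟪ σ ⟫)

_[_≔_] : ∀ {n} → Term (suc n) → Fin (suc n) → Term n → Term n
t [ x ≔ u ] = t ⟪ insertAt var x u ⟫

_[_] : ∀ {n} → Term (suc n) → Term n → Term n
t [ u ] = t [ zero ≔ u ]

infixr 7 _⟶_

_⟶_ : ∀ {n} → Term n → Term n → Term n
A ⟶ B = Π A (weaken B)

data _FreeIn_ {n : ℕ} (x : Fin n) : Term n → Set where
  var  : x FreeIn var x
  Πˡ   : ∀ {A B} → x FreeIn A → x FreeIn Π A B
  Πʳ   : ∀ {A B} → suc x FreeIn B → x FreeIn Π A B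
  ƛˡ   : ∀ {A t} → x FreeIn A → x FreeIn ƛ A t
  ƛʳ   : ∀ {A t} → suc x FreeIn t → x FreeIn ƛ A t
  appˡ : ∀ {t u} → x FreeIn t → x FreeIn (t · u)
  appʳ : ∀ {t u} → x FreeIn u → x FreeIn (t · u)

data Compatible (r : TermRel) {n : ℕ} : Rel (Term n) 0ℓ where
  root : ∀ {t u} → r t u → Compatible r t u
  Πˡ   : ∀ {A A′ B} → Compatible r A A′ → Compatible r (Π A B) (Π A′ B)
  Πʳ   : ∀ {A B B′} → Compatible r B B′ → Compatible r (Π A B) (Π A B′)
  ƛˡ   : ∀ {A A′ t} → Compatible r A A′ → Compatible r (ƛ A t) (ƛ A′ t)
  ƛʳ   : ∀ {A t t′} → Compatible r t t′ → Compatible r (ƛ A t) (ƛ A t′)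
  appˡ : ∀ {t t′ u} → Compatible r t t′ → Compatible r (t · u) (t′ · u)
  appʳ : ∀ {t u u′} → Compatible r u u′ → Compatible r (t · u) (t · u′)

data β {n : ℕ} : Rel (Term n) 0ℓ where
  beta : ∀ {A t u} → β (ƛ A t · u) (t [ u ])

-- Ext k n: contexts declaring n ∸ k variables, in order, on top of a
-- scope of k variables.

infixl 5 _▹_ _++_

data Ext (k : ℕ) : ℕ → Set where
  []  : Ext k k
  _▹_ : ∀ {n} → Ext k n → Term n → Ext k (suc n)

_++_ : ∀ {k m n} → Ext k m → Ext m n → Ext k n
Γ ++ []      = Γ
Γ ++ (Δ ▹ A) = (Γ ++ Δ) ▹ A

infix 4 _∋_∶_

data _∋_∶_ {k : ℕ} : ∀ {n} → Ext k n → Fin n → Term n → Set where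
  here  : ∀ {n} {Γ : Ext k n} {A} → Γ ▹ A ∋ zero ∶ weaken A
  there : ∀ {n} {Γ : Ext k n} {x A B} →
          Γ ∋ x ∶ A → Γ ▹ B ∋ suc x ∶ weaken A

-- The position in the scope n of Γ of a variable of the base scope k; it
-- depends only on k and n.

base : ∀ {k n} → Ext k n → Fin k → Fin n
base []      c = c
base (Γ ▹ _) c = suc (base Γ c)

record Rule (k : ℕ) : Set where
  constructor rule
  field
    {size}  : ℕ
    ctx     : Ext k size
    lhs rhs : Term size

-- Root reduction. The substitution θ acts on the variables of the rule
-- context only, i.e. it fixes the constants; Δ serves only to locate the k
-- constants in the scope n.

data Root {k : ℕ} (R : Pred (Rule k) 0ℓ) {n : ℕ} : Rel (Term n) 0ℓ where
  fire : ∀ {ρ} → R ρ → let open Rule ρ in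
         (Δ : Ext k n) (θ : Fin size → Term n) →
         (∀ c → θ (base ctx c) ≡ var (base Δ c)) →
         Root R (lhs ⟪ θ ⟫) (rhs ⟪ θ ⟫)

-- The k variables of Σ are the constants; a judgement Γ ⊢ t ∶ A has Σ
-- implicitly in front of Γ, and t and A live in the scope of Σ, Γ.

module Modulo {k : ℕ} (Σ : Ext 0 k) (R : Pred (Rule k) 0ℓ) where

  infix 4 _⟶¹_ _≡βR_ ⊢_ _⊢_∶_

  _⟶¹_ : TermRel
  _⟶¹_ = Compatible (β ∪ Root R)

  _≡βR_ : TermRel
  _≡βR_ = EqClosure _⟶¹_

  mutual

    data ⊢_ : ∀ {n} → Ext k n → Set where
      empty   : ⊢ []
      declare : ∀ {n} {Γ : Ext k n} {A} s → Γ ⊢ A ∶ sort s → ⊢ Γ ▹ A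

    data _⊢_∶_ : ∀ {n} → Ext k n → Term n → Term n → Set where
      ⊢sort : ∀ {n} {Γ : Ext k n} →
              ⊢ Γ → Γ ⊢ sort Type ∶ sort Kind
      ⊢var  : ∀ {n} {Γ : Ext k n} {x A} →
              ⊢ Γ → Σ ++ Γ ∋ x ∶ A → Γ ⊢ var x ∶ A
      ⊢Π    : ∀ {n} {Γ : Ext k n} {A B} s →
              Γ ⊢ A ∶ sort Type → Γ ▹ A ⊢ B ∶ sort s →
              Γ ⊢ Π A B ∶ sort s
      ⊢ƛ    : ∀ {n} {Γ : Ext k n} {A B t} s →
              Γ ⊢ A ∶ sort Type → Γ ▹ A ⊢ B ∶ sort s → Γ ▹ A ⊢ t ∶ B →
              Γ ⊢ ƛ A t ∶ Π A B
      ⊢app  : ∀ {n} {Γ : Ext k n} {A B t u} →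
              Γ ⊢ t ∶ Π A B → Γ ⊢ u ∶ A → Γ ⊢ t · u ∶ B [ u ]
      ⊢conv : ∀ {n} {Γ : Ext k n} {A B t} s →
              Γ ⊢ A ∶ sort s → Γ ⊢ B ∶ sort s → Γ ⊢ t ∶ A → A ≡βR B →
              Γ ⊢ t ∶ B

  data Interpreted {n : ℕ} (Γ : Ext k n) : Term n → Set where
    typed : ∀ {t A} → Γ ⊢ t ∶ A → Interpreted Γ t
    kind  : ⊢ Γ → Interpreted Γ (sort Kind)

module λΠ = Modulo [] (λ _ → ⊥)

record WellTyped {k : ℕ} (Σ : Ext 0 k) (ρ : Rule k) : Set where
  open Rule ρ
  field
    wellFormed : λΠ.⊢ (Σ ++ ctx)
    {type}     : Term size
    lhs-typed  : (Σ ++ ctx) λΠ.⊢ lhs ∶ type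
    rhs-typed  : (Σ ++ ctx) λΠ.⊢ rhs ∶ type

record Theory : Set₁ where
  field
    {#constants} : ℕ
    Σ            : Ext 0 #constants
    R            : Pred (Rule #constants) 0ℓ
    wellFormed   : λΠ.⊢ Σ
    normalˡ      : ∀ {ρ} → R ρ → IsNormalForm (Compatible β) (Rule.lhs ρ)
    normalʳ      : ∀ {ρ} → R ρ → IsNormalForm (Compatible β) (Rule.rhs ρ)
    wellTyped    : ∀ {ρ} → R ρ → WellTyped Σ ρ

  open Modulo Σ R public

Confluent : Theory → Set
Confluent T = ∀ {n} → ConfluentRel (_⟶¹_ {n})
  where open Theory T

SubjectReduction : Theory → Set
SubjectReduction T = ∀ {n} {Γ : Ext #constants n} {t u A} →
                     Γ ⊢ t ∶ A → t ⟶¹ u → Γ ⊢ u ∶ A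
  where open Theory T

-- Only the values at the variables declared in a context matter; those at
-- the constants are ignored (see "depends" and "Valid" below).

Valuation : ℕ → Set₁
Valuation n = Vector V n

-- A sequence φ₁, …, φⱼ of valuations is the vector φⱼ ∷ … ∷ φ₁ ∷ [], and
-- D j t (φⱼ ∷ … ∷ φ₁ ∷ []) stands for Dʲ⁺¹ at t, φ₁, …, φⱼ.

Interpretation : Set₁
Interpretation = (j : ℕ) → ∀ {n} → Term n → Vec (Valuation n) j → V

module _ (D : Interpretation) where

  -- (φ₁, x = D²ᵤ), …, (φⱼ, x = Dʲ⁺¹ᵤ): the value of x in the i-th valuation
  -- has to be an element of Dⁱ_A for x : A, and it is Dⁱ⁺¹ᵤ that is one.

  assign : ∀ {n j} → Fin (suc n) → Term n →
           Vec (Valuation n) j → Vec (Valuation (suc n)) j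
  assign x u []                   = []
  assign x u (_∷_ {n = j} φ φs) =
    insertAt φ x (D (suc j) u (φ ∷ φs)) ∷ assign x u φs

  -- Tuples c₁ ∈ D¹_C, …, cⱼ ∈ Dʲ_C.

  Tuple : ∀ {n j} → Term n → Vec (Valuation n) j → Set
  Tuple C []                  = ⊤
  Tuple C (_∷_ {n = j} φ φs) = Tuple C φs × Index (D j C φs)

  bind : ∀ {n j} (C : Term n) (φs : Vec (Valuation n) j) →
         Tuple C φs → Vec (Valuation (suc n)) j
  bind C []                  _        = []
  bind C (_∷_ {n = j} φ φs) (cs , c) =
    insertAt φ zero (elem (D j C φs) c) ∷ bind C φs cs

  -- { D_E at (φ₁, x = c₁), …, (φⱼ, x = cⱼ) | c₁ ∈ D¹_C, …, cⱼ ∈ Dʲ_C }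

  range : ∀ {n j} → Term n → Term (suc n) → Vec (Valuation n) j → V
  range {j = j} C E φs = sup (Tuple C φs) (λ cs → D j E (bind C φs cs))

  Valid : ∀ {k n j} → Ext k n → Vec (Valuation n) j → Set
  Valid Γ []                  = ⊤
  Valid Γ (_∷_ {n = j} φ φs) =
    Valid Γ φs × (∀ {x A} → Γ ∋ x ∶ A → φ x ∈ D j A φs)

record Model (T : Theory) (B : ΠAlgebra) : Set₁ where
  open Theory T
  open ΠAlgebra B

  -- The dimension of the model is 2 + r, so that the last two functions are
  -- D r and D (suc r); D j is irrelevant for larger j.

  field
    r : ℕ
    D : Interpretation

  ⟦_⟧_ : ∀ {n} → Term n → Vec (Valuation n) (suc r) → V
  ⟦ t ⟧ φs = D (suc r) t φs

  field
    member : ∀ {n} {Γ : Ext #constants n} {t A j} → suc j < 2 + r →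
      Γ ⊢ t ∶ A → (φ : Valuation n) (φs : Vec (Valuation n) j) →
      Valid D Γ (φ ∷ φs) → D (suc j) t (φ ∷ φs) ∈ D j A φs

    -- The same term in two contexts is, in de Bruijn notation, a term and
    -- its image under an injective renaming that fixes the constants.

    depends : ∀ {m n} {Γ : Ext #constants m} {Δ : Ext #constants n}
      (ρ : Fin m → Fin n) → Injective _≡_ _≡_ ρ →
      (∀ c → ρ (base Γ c) ≡ base Δ c) →
      ∀ {t j} → j < 2 + r → Interpreted Γ t → Interpreted Δ (rename ρ t) →
      (φs : Vec (Valuation m) j) (ψs : Vec (Valuation n) j) →
      Valid D Γ φs → Valid D Δ ψs →
      Pointwise (λ φ ψ → ∀ {x A} → Γ ∋ x ∶ A → x FreeIn t → φ x ≐ ψ (ρ x))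
                φs ψs →
      D j t φs ≐ D j (rename ρ t) ψs

    -- x is any variable of Γ, not only the last one; Δ is any context in
    -- which u and (u/x)t are typed, e.g. Γ with x replaced by u.

    substitution : ∀ {n} {Γ : Ext #constants (suc n)} {Δ : Ext #constants n}
      {x A t C C′ u} →
      Γ ∋ x ∶ A → Γ ⊢ t ∶ C → Δ ⊢ u ∶ A [ x ≔ u ] → Δ ⊢ t [ x ≔ u ] ∶ C′ →
      (φs : Vec (Valuation n) (suc r)) →
      Valid D Δ φs → Valid D Γ (assign D x u φs) →
      ⟦ t [ x ≔ u ] ⟧ φs ≐ ⟦ t ⟧ assign D x u φs

    carrier : ∀ {n} {Γ : Ext #constants n} s (φs : Vec (Valuation n) r) →
      ⊢ Γ → Valid D Γ φs → D r (sort s) φs ≐ 𝓑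

    sort-value : ∀ {n} {Γ : Ext #constants n} s
      (φs : Vec (Valuation n) (suc r)) →
      ⊢ Γ → Valid D Γ φs → ⟦ sort s ⟧ φs ≐ value ⊤̃

    product-value : ∀ {n} {Γ : Ext #constants n} {C E A}
      (φs : Vec (Valuation n) (suc r)) →
      Γ ⊢ Π C E ∶ A → Valid D Γ φs →
      ∃ λ (c∈ : ⟦ C ⟧ φs ∈ 𝓑) → ∃ λ (S∈ : 𝓐 (range D C E φs)) →
      ⟦ Π C E ⟧ φs ≐ value (Π̃ ⟨ ⟦ C ⟧ φs , c∈ ⟩ (range D C E φs , S∈))

    constants : ∀ {c A} → Σ ∋ c ∶ A →
      (φs : Vec (Valuation #constants) (suc r)) →
      Valid D {#constants} [] φs →
      ∃ λ (a∈ : ⟦ A ⟧ φs ∈ 𝓑) → ⊤̃ ≤ ⟨ ⟦ A ⟧ φs , a∈ ⟩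

    congruence : ∀ {n} {Γ : Ext #constants n} {t u A A′ j} → j < 2 + r →
      Γ ⊢ t ∶ A → Γ ⊢ u ∶ A′ → t ≡βR u →
      (φs : Vec (Valuation n) j) → Valid D Γ φs → D j t φs ≐ D j u φs

SuperConsistent : Theory → Set₂
SuperConsistent T =
  ∀ (B : ΠAlgebra) → Full B → (O : Ordering B) → Complete O → Model T B

infixr 7 _⇒_

data SimpleType : Set where
  ι o : SimpleType
  _⇒_ : SimpleType → SimpleType → SimpleType

-- A simple type as a term, given the positions of the constants ι and o.

type : ∀ {n} → (i p : Fin n) → SimpleType → Term n
type i p ι       = var i
type i p o       = var p
type i p (A ⇒ B) = type i p A ⟶ type i p B

-- The constants, in order: ι, o, ⇒, the quantifiers, ε; the quantifiers
-- are listed from the last one to the first one.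

connectives : Ext 0 3
connectives = [] ▹ sort Type ▹ sort Type ▹ type 1F 0F (o ⇒ o ⇒ o)

quantifiers : (As : List SimpleType) → Ext 3 (length As + 3)
quantifiers []       = []
quantifiers (A ∷ As) = quantifiers As ▹
  type (length As ↑ʳ 2F) (length As ↑ʳ 1F) ((A ⇒ o) ⇒ o)

module STT (As : List SimpleType) where

  #As : ℕ
  #As = length As

  k : ℕ
  k = suc (#As + 3)

  constants : Ext 0 k
  constants = connectives ++ quantifiers As ▹ var (#As ↑ʳ 1F) ⟶ sort Type

  cι co c⇒ cε : Fin k
  cι = suc (#As ↑ʳ 2F)
  co = suc (#As ↑ʳ 1F)
  c⇒ = suc (#As ↑ʳ 0F)
  cε = zero

  c∀ : ∀ {A} → A ∈ₗ As → Fin k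
  c∀ A∈ = suc (index A∈ ↑ˡ 3)

  data Rules : Pred (Rule k) 0ℓ where
    implication : Rules (rule
      ([] ▹ var co ▹ var (suc co))
      (var (2 ↑ʳ cε) · (var (2 ↑ʳ c⇒) · var 1F · var 0F))
      ((var (2 ↑ʳ cε) · var 1F) ⟶ (var (2 ↑ʳ cε) · var 0F)))
    universal : ∀ {A} (A∈ : A ∈ₗ As) → Rules (rule
      ([] ▹ type cι co (A ⇒ o))
      (var (1 ↑ʳ cε) · (var (1 ↑ʳ c∀ A∈) · var 0F))
      (Π (type (1 ↑ʳ cι) (1 ↑ʳ co) A) (var (2 ↑ʳ cε) · (var 1F · var 0F))))

private

  type-rename : ∀ {m n} (ρ : Fin m → Fin n) {i p} A →
                rename ρ (type i p A) ≡ type (ρ i) (ρ p) A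
  type-weaken : ∀ {n} {i p : Fin n} A →
                weaken (type i p A) ≡ type (suc i) (suc p) A
  type-rename ρ ι       = refl
  type-rename ρ o       = refl
  type-rename ρ (A ⇒ B) = cong₂ Π (type-rename ρ A)
    (trans (cong (rename (liftᵣ ρ)) (type-weaken B))
    (trans (type-rename (liftᵣ ρ) B) (sym (type-weaken B))))
  type-weaken ι       = refl
  type-weaken o       = refl
  type-weaken (A ⇒ B) = cong₂ Π (type-weaken A)
    (trans (cong (rename (liftᵣ suc)) (type-weaken B))
    (trans (type-rename (liftᵣ suc) B) (sym (type-weaken B))))

  type-subst : ∀ {m n} {σ : Fin m → Term n} {i p i′ p′} →
               σ i ≡ var i′ → σ p ≡ var p′ → ∀ A →
               type i p A ⟪ σ ⟫ ≡ type i′ p′ A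
  type-subst σi σp ι = σi
  type-subst σi σp o = σp
  type-subst {σ = σ} σi σp (A ⇒ B) = cong₂ Π (type-subst σi σp A)
    (trans (cong (_⟪ liftₛ σ ⟫) (type-weaken B))
    (trans (type-subst (cong weaken σi) (cong weaken σp) B)
           (sym (type-weaken B))))

  type-normal : ∀ {n} {i p : Fin n} A →
                IsNormalForm (Compatible β) (type i p A)
  type-normal ι (_ , root ())
  type-normal o (_ , root ())
  type-normal (A ⇒ B) (_ , Πˡ r) = type-normal A (_ , r)
  type-normal {i = i} {p} (A ⇒ B) (C , Πʳ {B′ = B′} r) =
    type-normal B (B′ , subst (λ C → Compatible β C B′) (type-weaken B) r)

  open λΠ using (_⊢_∶_)

  []++ : ∀ {n} {Γ : Ext 0 n} {x A} → Γ ∋ x ∶ A → [] ++ Γ ∋ x ∶ A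
  []++ here      = here
  []++ (there x) = there ([]++ x)

  ⊢var : ∀ {n} {Γ : Ext 0 n} {x A} → λΠ.⊢ Γ → Γ ∋ x ∶ A → Γ ⊢ var x ∶ A
  ⊢var Γ x = λΠ.⊢var Γ ([]++ x)

  record Base {n : ℕ} (Γ : Ext 0 n) (i p : Fin n) : Set where
    field
      wf : λΠ.⊢ Γ
      ∋i : Γ ∋ i ∶ sort Type
      ∋p : Γ ∋ p ∶ sort Type

  open Base

  extend : ∀ {n} {Γ : Ext 0 n} {i p A s} → Base Γ i p → Γ ⊢ A ∶ sort s →
           Base (Γ ▹ A) (suc i) (suc p)
  extend {s = s} b A = record
    { wf = λΠ.declare s A ; ∋i = there (b .∋i) ; ∋p = there (b .∋p) }

  ⊢type : ∀ {n} {Γ : Ext 0 n} {i p} → Base Γ i p → ∀ A →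
          Γ ⊢ type i p A ∶ sort Type
  ⊢type b ι = ⊢var (b .wf) (b .∋i)
  ⊢type b o = ⊢var (b .wf) (b .∋p)
  ⊢type b (A ⇒ B) = λΠ.⊢Π Type (⊢type b A)
    (subst (λ C → _ ⊢ C ∶ sort Type) (sym (type-weaken B))
           (⊢type (extend b (⊢type b A)) B))

  ⊢app : ∀ {n} {Γ : Ext 0 n} {i p t u} A B →
         Γ ⊢ t ∶ type i p (A ⇒ B) → Γ ⊢ u ∶ type i p A →
         Γ ⊢ t · u ∶ type i p B
  ⊢app {t = t} {u} A B t∶ u∶ = subst (λ C → _ ⊢ t · u ∶ C)
    (trans (cong (_[ u ]) (type-weaken B)) (type-subst refl refl B))
    (λΠ.⊢app t∶ u∶)

  here-type : ∀ {n} {Γ : Ext 0 n} {i p} A →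
              Γ ▹ type i p A ∋ zero ∶ type (suc i) (suc p) A
  here-type {Γ = Γ} {i} {p} A =
    subst (Γ ▹ type i p A ∋ zero ∶_) (type-weaken A) here

  there-type : ∀ {n} {Γ : Ext 0 n} {x i p C} A →
               Γ ∋ x ∶ type i p A → Γ ▹ C ∋ suc x ∶ type (suc i) (suc p) A
  there-type {Γ = Γ} {x} {C = C} A ∋x =
    subst (Γ ▹ C ∋ suc x ∶_) (type-weaken A) (there ∋x)

  connectives-base : Base connectives 2F 1F
  connectives-base = extend (record
    { wf = wf₂ ; ∋i = there here ; ∋p = here }) (⊢type (record
    { wf = wf₂ ; ∋i = there here ; ∋p = here }) (o ⇒ o ⇒ o))
    where
    wf₂ : λΠ.⊢ [] ▹ sort Type ▹ sort Type
    wf₂ = λΠ.declare Kind (λΠ.⊢sort (λΠ.declare Kind (λΠ.⊢sort λΠ.empty)))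

  quantifiers-base : ∀ As → Base (connectives ++ quantifiers As)
                                 (length As ↑ʳ 2F) (length As ↑ʳ 1F)
  quantifiers-base []       = connectives-base
  quantifiers-base (A ∷ As) =
    extend b (⊢type b ((A ⇒ o) ⇒ o))
    where b = quantifiers-base As

  ∋⇒ : ∀ As → connectives ++ quantifiers As ∋ length As ↑ʳ 0F ∶
       type (length As ↑ʳ 2F) (length As ↑ʳ 1F) (o ⇒ o ⇒ o)
  ∋⇒ []       = here
  ∋⇒ (A ∷ As) = there-type {i = length As ↑ʳ 2F} (o ⇒ o ⇒ o) (∋⇒ As)

  ∋∀ : ∀ {A} As (A∈ : A ∈ₗ As) →
       connectives ++ quantifiers As ∋ index A∈ ↑ˡ 3 ∶
       type (length As ↑ʳ 2F) (length As ↑ʳ 1F) ((A ⇒ o) ⇒ o)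
  ∋∀ {A} (_ ∷ As) (here refl) = here-type ((A ⇒ o) ⇒ o)
  ∋∀ {A} (_ ∷ As) (there A∈) = there-type ((A ⇒ o) ⇒ o) (∋∀ As A∈)

module _ (As : List SimpleType) where

  open STT As

  private

    ⊢ε : connectives ++ quantifiers As ⊢ var (#As ↑ʳ 1F) ⟶ sort Type ∶ sort Kind
    ⊢ε = λΠ.⊢Π Kind p (λΠ.⊢sort (λΠ.declare Type p))
      where
      b = quantifiers-base As
      p = ⊢type b o

    constants-base : Base constants cι co
    constants-base = extend (quantifiers-base As) ⊢ε

    ⊢ε· : ∀ {n} {Γ : Ext 0 n} {e p t} → λΠ.⊢ Γ →
          Γ ∋ e ∶ var p ⟶ sort Type → Γ ⊢ t ∶ var p →
          Γ ⊢ var e · t ∶ sort Type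
    ⊢ε· Γ e t = λΠ.⊢app (⊢var Γ e) t

    rules-normalˡ : ∀ {ρ} → Rules ρ →
                    IsNormalForm (Compatible β) (Rule.lhs ρ)
    rules-normalˡ implication = λ where
      (_ , root ())
      (_ , appˡ (root ()))
      (_ , appʳ (root ()))
      (_ , appʳ (appˡ (root ())))
      (_ , appʳ (appˡ (appˡ (root ()))))
      (_ , appʳ (appˡ (appʳ (root ()))))
      (_ , appʳ (appʳ (root ())))
    rules-normalˡ (universal A∈) = λ where
      (_ , root ())
      (_ , appˡ (root ()))
      (_ , appʳ (root ()))
      (_ , appʳ (appˡ (root ())))
      (_ , appʳ (appʳ (root ())))

    rules-normalʳ : ∀ {ρ} → Rules ρ →
                    IsNormalForm (Compatible β) (Rule.rhs ρ)
    rules-normalʳ implication = λ where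
      (_ , root ())
      (_ , Πˡ (root ()))
      (_ , Πˡ (appˡ (root ())))
      (_ , Πˡ (appʳ (root ())))
      (_ , Πʳ (root ()))
      (_ , Πʳ (appˡ (root ())))
      (_ , Πʳ (appʳ (root ())))
    rules-normalʳ (universal {A} A∈) = λ where
      (_ , root ())
      (_ , Πˡ r) → type-normal A (_ , r)
      (_ , Πʳ (root ()))
      (_ , Πʳ (appˡ (root ())))
      (_ , Πʳ (appʳ (root ())))
      (_ , Πʳ (appʳ (appˡ (root ()))))
      (_ , Πʳ (appʳ (appʳ (root ()))))

    rules-typed : ∀ {ρ} → Rules ρ → WellTyped constants ρ
    rules-typed implication = record
      { wellFormed = b .wf
      ; lhs-typed  = ⊢ε· (b .wf) (there (there here))
          (⊢app {i = ι₂} o o (⊢app {i = ι₂} o (o ⇒ o) (⊢var (b .wf) c) x) y)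
      ; rhs-typed  = λΠ.⊢Π Type εx (⊢ε· (b′ .wf) (there (there (there here)))
          (⊢var (b′ .wf) (there here)))
      }
      where
      ι₂ = suc (suc cι)
      b₁ : Base (constants ▹ var co) (suc cι) (suc co)
      b₁ = extend constants-base (⊢type constants-base o)
      b : Base (constants ▹ var co ▹ var (suc co)) ι₂ (suc (suc co))
      b  = extend b₁ (⊢type b₁ o)
      c  = there-type {i = suc cι} (o ⇒ o ⇒ o)
             (there-type {i = cι} (o ⇒ o ⇒ o)
             (there-type {i = #As ↑ʳ 2F} (o ⇒ o ⇒ o) (∋⇒ As)))
      x  = ⊢var (b .wf) (there here)
      y  = ⊢var (b .wf) here
      εx = ⊢ε· (b .wf) (there (there here)) x
      b′ = extend b εx
    rules-typed (universal {A} A∈) = record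
      { wellFormed = b .wf
      ; lhs-typed  = ⊢ε· (b .wf) (there here)
          (⊢app (A ⇒ o) o (⊢var (b .wf) c) x)
      ; rhs-typed  = λΠ.⊢Π Type (⊢type b A)
          (⊢ε· (b′ .wf) (there (there here)) (⊢app A o x′ z))
      }
      where
      b : Base (constants ▹ type cι co (A ⇒ o)) (suc cι) (suc co)
      b  = extend constants-base (⊢type constants-base (A ⇒ o))
      c  = there-type ((A ⇒ o) ⇒ o) (there-type ((A ⇒ o) ⇒ o) (∋∀ As A∈))
      ∋x = here-type (A ⇒ o)
      x  = ⊢var (b .wf) ∋x
      b′ = extend b (⊢type b A)
      x′ = ⊢var (b′ .wf) (there-type (A ⇒ o) ∋x)
      z  = ⊢var (b′ .wf) (here-type A)

  simpleTypeTheory : Theory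
  simpleTypeTheory = record
    { Σ          = constants
    ; R          = Rules
    ; wellFormed = constants-base .wf
    ; normalˡ    = rules-normalˡ
    ; normalʳ    = rules-normalʳ
    ; wellTyped  = rules-typed
    }

module Submission where

-- The model has dimension 3. D¹ sends every kind to a universe of sets with
-- codes and every other term to { ∅ }. D² sends Π to a set of functions and
-- ignores arguments, so that every object has the value ∅ and both sides of
-- each rewrite rule have the value { ∅ }: functions are encoded à la Aczel, and
-- then any function space with codomain { ∅ } is { ∅ }. D³ sends ⇒ and ∀_A to
-- the evident operations of the algebra and ε to the identity. Since D² does
-- not see arguments, it factors on types through an erasure to codes, which is
-- preserved by conversion (by confluence and subject reduction); this replaces
-- the injectivity of Π in the proof that D³ is invariant under reduction.

-- The three levels are shaped by `ε`. For its value to be the identity, the carrier of `o` has to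
-- be `𝓑`, the carrier of `Type`. That carrier is in turn a member of the D¹-value of `Type`, which
-- therefore contains `𝓑` and `{ ∅ }` and is closed under function spaces; `Code` names the members
-- of this closure. The obstacle is that equality of sets is extensional: a function space such as
-- `{ ∅ }` does not reveal its domain, whereas inverting an application or an abstraction has to
-- recover the domain from the type. Codes keep this information, except where the codomain is
-- `{ ∅ }`, and there every function is `∅` anyway. The interpretations are total on raw terms, with
-- harmless values for ill-typed ones. Renaming and substitution are then purely structural, and
-- typing enters only for membership and for reduction.

open import Defs
open import Agda.Primitive using () renaming (lzero to 0ℓ)
open import Data.Bool using (Bool; true; false)
open import Data.Empty using (⊥; ⊥-elim)
open import Data.Fin
  using (Fin; zero; suc; _↑ˡ_; _↑ʳ_; toℕ; fromℕ<; opposite; punchIn; punchOut)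
open import Data.Fin.Patterns using (0F; 1F; 2F)
open import Data.Fin.Properties
  using (toℕ-injective; toℕ-fromℕ<; opposite-prop; _≟_; punchIn-punchOut)
open import Data.List using (List; []; _∷_; length)
open import Data.List.Membership.Propositional using () renaming (_∈_ to _∈ₗ_)
open import Data.List.Relation.Unary.Any using (here; there; index)
open import Data.List.Relation.Unary.Unique.Propositional using (Unique)
open import Data.Maybe using (Maybe; just; nothing; maybe′)
open import Data.Nat using (ℕ; zero; suc; _+_; _∸_; _≤_; _<_; _<?_; s≤s; s≤s⁻¹)
open import Data.Nat.Properties
  using (+-suc; +-cancelʳ-≡; suc-injective; m+n∸n≡m; ≤-refl; ≤-trans; ≤-reflexive;
         <-irrefl; ≤⇒≯; m≤n⇒m≤1+n; m≤n+m)
open import Data.Product using (∃; _×_; _,_; proj₁; proj₂)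
open import Data.Sum using (_⊎_; inj₁; inj₂)
open import Data.Unit using (⊤; tt)
open import Data.Vec using (Vec; []; _∷_)
open import Data.Vec.Functional using (insertAt) renaming (_∷_ to _◂_)
open import Data.Vec.Functional.Properties using (insertAt-lookup; insertAt-punchIn)
open import Data.Vec.Relation.Binary.Pointwise.Inductive using (Pointwise; []; _∷_)
open import Function.Base using (_∘_)
open import Function.Bundles using (Equivalence)
open import Function.Definitions using (Injective)
open import Relation.Binary.Construct.Closure.Equivalence using (EqClosure)
open import Relation.Binary.Construct.Closure.ReflexiveTransitive
  using (Star; ε; _◅_; _◅◅_)
open import Relation.Binary.Construct.Closure.Symmetric using (fwd; bwd)
open import Relation.Binary.Core using (Rel)
open import Relation.Binary.PropositionalEquality
  using (_≡_; refl; sym; trans; cong; cong₂; subst; isEquivalence)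
open import Relation.Binary.Rewriting using () renaming (Confluent to ConfluentRel)
open import Relation.Binary.Structures using (IsEquivalence; IsPreorder)
open import Relation.Nullary using (¬_; yes; no)
open import Relation.Unary using (Pred)

open Element

-- Sets and functions

≐-refl : ∀ x → x ≐ x
≐-refl (sup I f) = (λ i → i , ≐-refl (f i)) , (λ i → i , ≐-refl (f i))

≐-sym : ∀ {x y} → x ≐ y → y ≐ x
≐-sym {sup I f} {sup J g} (p , q) =
  (λ j → proj₁ (q j) , ≐-sym (proj₂ (q j))) ,
  (λ i → proj₁ (p i) , ≐-sym (proj₂ (p i)))

≐-trans : ∀ {x y z} → x ≐ y → y ≐ z → x ≐ z
≐-trans {sup I f} {sup J g} {sup K h} (p , q) (p′ , q′) =
  (λ i → let j , e = p i ; k , e′ = p′ j in k , ≐-trans e e′) ,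
  (λ k → let j , e = q′ k ; i , e′ = q j in i , ≐-trans e′ e)

-- ≐ and ∈ compute, so that their arguments cannot be inferred; the records
-- ≋ and ∊ stand for them.

infix 4 _≋_ _∊_

record _≋_ (x y : V) : Set where
  constructor equal
  field ≋⇒≐ : x ≐ y

record _∊_ (x y : V) : Set where
  constructor at
  field
    position : Index y
    ≋elem    : x ≋ elem y position

open _≋_
open _∊_

≋-refl : ∀ {x} → x ≋ x
≋-refl = equal (≐-refl _)

≋-reflexive : ∀ {x y} → x ≡ y → x ≋ y
≋-reflexive refl = ≋-refl

≋-sym : ∀ {x y} → x ≋ y → y ≋ x
≋-sym (equal e) = equal (≐-sym e)

≋-trans : ∀ {x y z} → x ≋ y → y ≋ z → x ≋ z
≋-trans (equal e) (equal e′) = equal (≐-trans e e′)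

≋-isEquivalence : IsEquivalence _≋_
≋-isEquivalence = record { refl = ≋-refl ; sym = ≋-sym ; trans = ≋-trans }

∊⇒∈ : ∀ {x y} → x ∊ y → x ∈ y
∊⇒∈ (at i e) = i , ≋⇒≐ e

∈⇒∊ : ∀ {x y} → x ∈ y → x ∊ y
∈⇒∊ (i , e) = at i (equal e)

≋⇒elem∊ : ∀ {x y} → x ≋ y → ∀ i → elem x i ∊ y
≋⇒elem∊ {sup _ _} {sup _ _} (equal (p , _)) i = ∈⇒∊ (p i)

≋-ext : ∀ {x y} → (∀ i → elem x i ∊ y) → (∀ j → elem y j ∊ x) → x ≋ y
≋-ext {sup _ _} {sup _ _} p q = equal
  ((λ i → ∊⇒∈ (p i)) , λ j → let i , e = ∊⇒∈ (q j) in i , ≐-sym e)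

∊-respˡ : ∀ {x x′ y} → x ≋ x′ → x ∊ y → x′ ∊ y
∊-respˡ e (at j p) = at j (≋-trans (≋-sym e) p)

∊-respʳ : ∀ {x y y′} → y ≋ y′ → x ∊ y → x ∊ y′
∊-respʳ e (at j p) = ∊-respˡ (≋-sym p) (≋⇒elem∊ e j)

elem∊ : ∀ x i → elem x i ∊ x
elem∊ x i = at i ≋-refl

≋-ext-∊ : ∀ {x y} → (∀ z → z ∊ x → z ∊ y) → (∀ z → z ∊ y → z ∊ x) → x ≋ y
≋-ext-∊ p q = ≋-ext (λ i → p _ (elem∊ _ i)) (λ j → q _ (elem∊ _ j))

∅ : V
∅ = sup ⊥ λ ()

≋∅ : ∀ {x} → (Index x → ⊥) → x ≋ ∅
≋∅ {sup _ _} empty = ≋-ext (λ i → ⊥-elim (empty i)) λ ()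

single : V → V
single x = sup ⊤ λ _ → x

∊-single : ∀ {x z} → z ∊ single x → z ≋ x
∊-single (at _ e) = e

single-cong : ∀ {x y} → x ≋ y → single x ≋ single y
single-cong e = ≋-ext (λ _ → at tt e) (λ _ → at tt (≋-sym e))

image : (X : V) → (Index X → V) → V
image X h = sup (Index X) h

image-cong : ∀ {X Y} {h : Index X → V} {g : Index Y → V} → X ≋ Y →
             (∀ i j → elem X i ≋ elem Y j → h i ≋ g j) → image X h ≋ image Y g
image-cong X≋Y h≋g = ≋-ext
  (λ i → let at j e = ≋⇒elem∊ X≋Y i in at j (h≋g i j e))
  (λ j → let at i e = ≋⇒elem∊ (≋-sym X≋Y) j in at i (≋-sym (h≋g i j (≋-sym e))))

image-const : ∀ {X x} {h : Index X → V} → Index X → (∀ i → h i ≋ x) →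
              image X h ≋ single x
image-const i₀ e = ≋-ext (λ i → at tt (e i)) (λ _ → at i₀ (≋-sym (e i₀)))

-- Ordered pairs, functions and function spaces

unordered : V → V → V
unordered x y = sup Bool λ { true → x ; false → y }

∊-unordered : ∀ {x y z} → z ∊ unordered x y → z ≋ x ⊎ z ≋ y
∊-unordered (at true e)  = inj₁ e
∊-unordered (at false e) = inj₂ e

∊-unorderedʳ : ∀ x y → y ∊ unordered x y
∊-unorderedʳ x y = at false ≋-refl

unordered-cong : ∀ {x x′ y y′} → x ≋ x′ → y ≋ y′ → unordered x y ≋ unordered x′ y′
unordered-cong p q = ≋-ext
  (λ { true → at true p ; false → at false q })
  (λ { true → at true (≋-sym p) ; false → at false (≋-sym q) })

single-injective : ∀ {x y} → single x ≋ single y → x ≋ y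
single-injective e = ∊-single (≋⇒elem∊ e tt)

unordered≋single : ∀ {x y z} → unordered x y ≋ single z → x ≋ z × y ≋ z
unordered≋single e =
  ∊-single (≋⇒elem∊ e true) , ∊-single (≋⇒elem∊ e false)

opaque

  pair : V → V → V
  pair x y = unordered (single x) (unordered x y)

  pair-cong : ∀ {x x′ y y′} → x ≋ x′ → y ≋ y′ → pair x y ≋ pair x′ y′
  pair-cong p q = unordered-cong (single-cong p) (unordered-cong p q)

  -- The second component is reachable through indices of the pair itself. This lets `app` collect
  -- second components with an index type in `Set`, although it cannot quantify over `V`.
  pair-second : ∀ {x y z} → pair x y ≋ z → ∃ λ i → y ∊ elem z i
  pair-second {x} {y} e =
    let at i p = ≋⇒elem∊ e false in i , ∊-respʳ p (∊-unorderedʳ x y)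

  pair-injective : ∀ {a b c d} → pair a b ≋ pair c d → a ≋ c × b ≋ d
  pair-injective {a} {b} {c} {d} e = a≋c , b≋d
    where
    a≋c : a ≋ c
    a≋c with ∊-unordered (≋⇒elem∊ e true)
    ... | inj₁ p = single-injective p
    ... | inj₂ p = ≋-sym (proj₁ (unordered≋single (≋-sym p)))
    -- The degenerate case: matching the second member of the left pair may identify `b` with `c`
    -- only; the second member of the right pair then brings in `d`.
    b≋c⇒b≋d : b ≋ c → b ≋ d
    b≋c⇒b≋d b≋c with ∊-unordered (≋⇒elem∊ (≋-sym e) false)
    ... | inj₁ p = ≋-trans b≋c
                     (≋-trans (≋-sym a≋c) (≋-sym (proj₂ (unordered≋single p))))
    ... | inj₂ p with ∊-unordered (≋⇒elem∊ p false)
    ...   | inj₁ q = ≋-trans b≋c (≋-trans (≋-sym a≋c) (≋-sym q))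
    ...   | inj₂ q = ≋-sym q
    b≋d : b ≋ d
    b≋d with ∊-unordered (≋⇒elem∊ e false)
    ... | inj₁ p = b≋c⇒b≋d (proj₂ (unordered≋single p))
    ... | inj₂ p with ∊-unordered (≋⇒elem∊ p false)
    ...   | inj₁ q = b≋c⇒b≋d q
    ...   | inj₂ q = q

-- Aczel's encoding of functions, { (x , y) ∣ x ∈ X , y ∈ h x }: the function
-- with constant value ∅ is ∅ whatever its domain, so that every function
-- space with codomain { ∅ } equals { ∅ }.

opaque

  lam : (X : V) → (Index X → V) → V
  lam X h = sup (∃ λ i → Index (h i)) λ (i , j) → pair (elem X i) (elem (h i) j)

  ∊-lam⁺ : ∀ {X h x y} i → x ≋ elem X i → y ∊ h i → pair x y ∊ lam X h
  ∊-lam⁺ i x≋ (at j y≋) = at (i , j) (pair-cong x≋ y≋)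

  ∊-lam⁻ : ∀ {X h x y} → pair x y ∊ lam X h → ∃ λ i → x ≋ elem X i × y ∊ h i
  ∊-lam⁻ (at (i , j) e) = let p , q = pair-injective e in i , p , at j q

  lam⊆ : ∀ {X h Y g} → (∀ i → ∃ λ j → elem X i ≋ elem Y j × h i ≋ g j) →
         ∀ i → elem (lam X h) i ∊ lam Y g
  lam⊆ {Y = Y} {g} m (i , l) =
    let j , p , q = m i in ∊-lam⁺ {Y} {g} j p (≋⇒elem∊ q l)

  lam-∅ : ∀ {X} → lam X (λ _ → ∅) ≋ ∅
  lam-∅ = ≋∅ λ ()

opaque

  -- In Aczel's encoding the value at `x` is the set of all `y` with `pair x y` in `f`. Candidates
  -- for `y` are the members of members of members of `f`, which keeps the index type small.
  app : V → V → V
  app f x = sup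
    (∃ λ i → ∃ λ j → ∃ λ k → elem f i ≋ pair x (elem (elem (elem f i) j) k))
    (λ (i , j , k , _) → elem (elem (elem f i) j) k)

  ∊-app⁺ : ∀ {f x y} → pair x y ∊ f → y ∊ app f x
  ∊-app⁺ (at i e) =
    let j , at k p = pair-second e
    in at (i , j , k , ≋-trans (≋-sym e) (pair-cong ≋-refl p)) p

  ∊-app⁻ : ∀ {f x y} → y ∊ app f x → pair x y ∊ f
  ∊-app⁻ (at (i , j , k , e) p) =
    at i (≋-trans (pair-cong ≋-refl p) (≋-sym e))

app-cong : ∀ {f f′ x x′} → f ≋ f′ → x ≋ x′ → app f x ≋ app f′ x′
app-cong f≋ x≋ = ≋-ext-∊
  (λ z z∊ → ∊-app⁺ (∊-respʳ f≋ (∊-respˡ (pair-cong x≋ ≋-refl) (∊-app⁻ z∊))))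
  (λ z z∊ → ∊-app⁺ (∊-respʳ (≋-sym f≋)
     (∊-respˡ (pair-cong (≋-sym x≋) ≋-refl) (∊-app⁻ z∊))))

lam-cong : ∀ {X Y} {h : Index X → V} {g : Index Y → V} → X ≋ Y →
           (∀ i j → elem X i ≋ elem Y j → h i ≋ g j) → lam X h ≋ lam Y g
lam-cong X≋Y h≋g = ≋-ext
  (lam⊆ λ i → let at j e = ≋⇒elem∊ X≋Y i in j , e , h≋g i j e)
  (lam⊆ λ j → let at i e = ≋⇒elem∊ (≋-sym X≋Y) j in
    i , e , ≋-sym (h≋g i j (≋-sym e)))

Extensional : (X : V) → (Index X → V) → Set
Extensional X h = ∀ i j → elem X i ≋ elem X j → h i ≋ h j

app-lam : ∀ {X h x} → Extensional X h → ∀ i → x ≋ elem X i → app (lam X h) x ≋ h i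
app-lam h-ext i x≋ = ≋-ext-∊
  (λ z z∊ → let j , x≋′ , z∊′ = ∊-lam⁻ (∊-app⁻ z∊) in
    ∊-respʳ (h-ext j i (≋-trans (≋-sym x≋′) x≋)) z∊′)
  (λ z z∊ → ∊-app⁺ (∊-lam⁺ i x≋ z∊))

opaque

  Fun : V → V → V
  Fun X Y = sup (∃ λ (f : Index X → Index Y) → Extensional X (λ i → elem Y (f i)))
                (λ (f , _) → lam X (λ i → elem Y (f i)))

  ∊-Fun⁺ : ∀ {X Y h} → Extensional X h → (∀ i → h i ∊ Y) → lam X h ∊ Fun X Y
  ∊-Fun⁺ h-ext h∊ = at
    ((λ i → position (h∊ i)) ,
     λ i j e → ≋-trans (≋-sym (≋elem (h∊ i))) (≋-trans (h-ext i j e) (≋elem (h∊ j))))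
    (lam-cong ≋-refl λ i j e → ≋-trans (h-ext i j e) (≋elem (h∊ j)))

  ∊-Fun⁻ : ∀ {X Y f} → f ∊ Fun X Y →
           ∃ λ h → Extensional X h × (∀ i → h i ∊ Y) × f ≋ lam X h
  ∊-Fun⁻ {Y = Y} (at (g , g-ext) e) = _ , g-ext , (λ i → elem∊ Y (g i)) , e

app∊ : ∀ {X Y f x} → f ∊ Fun X Y → x ∊ X → app f x ∊ Y
app∊ f∊ (at i x≋) =
  let h , h-ext , h∊ , f≋ = ∊-Fun⁻ f∊
  in ∊-respˡ (≋-sym (≋-trans (app-cong f≋ ≋-refl) (app-lam h-ext i x≋))) (h∊ i)

Fun-mono : ∀ {X X′ Y Y′ f} → X ≋ X′ → Y ≋ Y′ → f ∊ Fun X Y → f ∊ Fun X′ Y′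
Fun-mono {X} {X′} {Y} {Y′} X≋ Y≋ f∊ =
  let h , h-ext , h∊ , f≋ = ∊-Fun⁻ f∊
  in ∊-respˡ
       (≋-sym (≋-trans f≋ (lam-cong X≋ λ i j e → h-ext _ _ (≋-trans e (back-≋ j)))))
       (∊-Fun⁺ (λ i j e → h-ext _ _ (≋-trans (≋-sym (back-≋ i)) (≋-trans e (back-≋ j))))
               (λ i → ∊-respʳ Y≋ (h∊ (back i))))
  where
  back : Index X′ → Index X
  back i = position (≋⇒elem∊ (≋-sym X≋) i)
  back-≋ : ∀ i → elem X′ i ≋ elem X (back i)
  back-≋ i = ≋elem (≋⇒elem∊ (≋-sym X≋) i)

Fun-cong : ∀ {X X′ Y Y′} → X ≋ X′ → Y ≋ Y′ → Fun X Y ≋ Fun X′ Y′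
Fun-cong X≋ Y≋ = ≋-ext-∊
  (λ _ → Fun-mono X≋ Y≋) (λ _ → Fun-mono (≋-sym X≋) (≋-sym Y≋))

lam-const-∅ : ∀ {X h} → (∀ i → h i ≋ ∅) → lam X h ≋ ∅
lam-const-∅ h≋ = ≋-trans (lam-cong ≋-refl λ i _ _ → h≋ i) lam-∅

Fun-single-∅ : ∀ {X} → Fun X (single ∅) ≋ single ∅
Fun-single-∅ = ≋-ext-∊
  (λ _ f∊ → let _ , _ , h∊ , f≋ = ∊-Fun⁻ f∊ in
    at tt (≋-trans f≋ (lam-const-∅ λ i → ∊-single (h∊ i))))
  (λ _ z∊ → ∊-respˡ (≋-trans lam-∅ (≋-sym (∊-single z∊)))
    (∊-Fun⁺ (λ _ _ _ → ≋-refl) (λ _ → at tt ≋-refl)))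

-- Terms and their classification

rename-id : ∀ {n} {f : Fin n → Fin n} → (∀ x → f x ≡ x) → ∀ t → rename f t ≡ t
liftᵣ-id : ∀ {n} {f : Fin n → Fin n} → (∀ x → f x ≡ x) → ∀ x → liftᵣ f x ≡ x
liftᵣ-id f≡ zero    = refl
liftᵣ-id f≡ (suc x) = cong suc (f≡ x)
rename-id f≡ (var x)  = cong var (f≡ x)
rename-id f≡ (sort s) = refl
rename-id f≡ (Π A B)  = cong₂ Π (rename-id f≡ A) (rename-id (liftᵣ-id f≡) B)
rename-id f≡ (ƛ A t)  = cong₂ ƛ (rename-id f≡ A) (rename-id (liftᵣ-id f≡) t)
rename-id f≡ (t · u)  = cong₂ _·_ (rename-id f≡ t) (rename-id f≡ u)

-- One recursion yields both D² and the erasure to codes, so that comparing them is structural.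
-- Application discards its argument, hence no binder needs to know what it is applied to, and all
-- bound variables receive the same default `d`.
module Fold {a} {A : Set a} {_~_ : Rel A 0ℓ} (~-equiv : IsEquivalence _~_)
            (s : A) (π : A → A → A)
            (π-cong : ∀ {x x′ y y′} → x ~ x′ → y ~ y′ → π x y ~ π x′ y′)
            (d : A) where

  private module ~ = IsEquivalence ~-equiv

  fold : ∀ {n} → Term n → (Fin n → A) → A
  fold (var x)  ρ = ρ x
  fold (sort _) ρ = s
  fold (Π C E)  ρ = π (fold C ρ) (fold E (d ◂ ρ))
  fold (ƛ C t)  ρ = fold t (d ◂ ρ)
  fold (t · u)  ρ = fold t ρ

  fold-rename : ∀ {m n} {f : Fin m → Fin n} {ρ ρ′} t →
                (∀ x → x FreeIn t → ρ x ~ ρ′ (f x)) →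
                fold t ρ ~ fold (rename f t) ρ′
  fold-rename (var x)  h = h x var
  fold-rename (sort _) h = ~.refl
  fold-rename (Π C E)  h = π-cong (fold-rename C λ x → h x ∘ Πˡ)
    (fold-rename E λ { zero _ → ~.refl ; (suc x) → h x ∘ Πʳ })
  fold-rename (ƛ C t)  h =
    fold-rename t λ { zero _ → ~.refl ; (suc x) → h x ∘ ƛʳ }
  fold-rename (t · u)  h = fold-rename t λ x → h x ∘ appˡ

  fold-weaken : ∀ {n c} {ρ : Fin n → A} t → fold t ρ ~ fold (weaken t) (c ◂ ρ)
  fold-weaken t = fold-rename t λ _ _ → ~.refl

  fold-subst : ∀ {m n} {σ : Fin m → Term n} {ρ ρ′} t →
               (∀ x → ρ x ~ fold (σ x) ρ′) → fold t ρ ~ fold (t ⟪ σ ⟫) ρ′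
  fold-subst-liftₛ : ∀ {m n} {σ : Fin m → Term n} {ρ ρ′} t →
                     (∀ x → ρ x ~ fold (σ x) ρ′) →
                     fold t (d ◂ ρ) ~ fold (t ⟪ liftₛ σ ⟫) (d ◂ ρ′)
  fold-subst (var x)  h = h x
  fold-subst (sort _) h = ~.refl
  fold-subst (Π C E)  h = π-cong (fold-subst C h) (fold-subst-liftₛ E h)
  fold-subst (ƛ C t)  h = fold-subst-liftₛ t h
  fold-subst (t · u)  h = fold-subst t h
  fold-subst-liftₛ {σ = σ} t h = fold-subst t λ where
    zero    → ~.refl
    (suc x) → ~.trans (h x) (fold-weaken (σ x))

  -- The hypothesis is the price of a fixed default at binders: contracting a redex is harmless when
  -- the argument itself has value `d`, as objects do.
  fold-[] : ∀ {n} {ρ : Fin n → A} t {u} → fold u ρ ~ d →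
            fold t (d ◂ ρ) ~ fold (t [ u ]) ρ
  fold-[] t u~d = fold-subst t λ { zero → ~.sym u~d ; (suc x) → ~.refl }

-- A variable stands for an object or for a type family; all bound variables
-- stand for objects.

data Level : Set where
  obj fam : Level

-- A syntactic shadow of typing that is stable under substitution: domains are families, arguments
-- are objects, and applications and abstractions inherit the level of their head or body.
data Low {n} (ℓ : Fin n → Level) : Level → Term n → Set where
  var : ∀ {x l} → ℓ x ≡ l → Low ℓ l (var x)
  Π   : ∀ {A B} → Low ℓ fam A → Low (obj ◂ ℓ) fam B → Low ℓ fam (Π A B)
  ƛ   : ∀ {A t l} → Low ℓ fam A → Low (obj ◂ ℓ) l t → Low ℓ l (ƛ A t)
  _·_ : ∀ {t u l} → Low ℓ l t → Low ℓ obj u → Low ℓ l (t · u)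

data IsKind {n} (ℓ : Fin n → Level) : Term n → Set where
  sort : IsKind ℓ (sort Type)
  Π    : ∀ {A K} → Low ℓ fam A → IsKind (obj ◂ ℓ) K → IsKind ℓ (Π A K)

data Sorted {n} (ℓ : Fin n → Level) : Term n → Term n → Set where
  object : ∀ {t A} → Low ℓ obj t → Low ℓ fam A → Sorted ℓ t A
  family : ∀ {t A} → Low ℓ fam t → IsKind ℓ A → Sorted ℓ t A
  kind   : ∀ {t} → IsKind ℓ t → Sorted ℓ t (sort Kind)

Low⇒¬IsKind : ∀ {n} {ℓ : Fin n → Level} {l t} → Low ℓ l t → ¬ IsKind ℓ t
Low⇒¬IsKind (Π _ B) (Π _ K) = Low⇒¬IsKind B K

private
  variable
    k m n : ℕ
    ℓ ℓ′ : Fin n → Level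
    l : Level
    t u A B C : Term n

liftᵣ-level : {f : Fin m → Fin n} → (∀ x → ℓ′ (f x) ≡ ℓ x) →
              ∀ x → (l ◂ ℓ′) (liftᵣ f x) ≡ (l ◂ ℓ) x
liftᵣ-level h zero    = refl
liftᵣ-level h (suc x) = h x

Low-rename : {f : Fin m → Fin n} → (∀ x → ℓ′ (f x) ≡ ℓ x) →
             Low ℓ l t → Low ℓ′ l (rename f t)
Low-rename h (var e) = var (trans (h _) e)
Low-rename h (Π A B) = Π (Low-rename h A) (Low-rename (liftᵣ-level h) B)
Low-rename h (ƛ A t) = ƛ (Low-rename h A) (Low-rename (liftᵣ-level h) t)
Low-rename h (t · u) = Low-rename h t · Low-rename h u

IsKind-rename : {f : Fin m → Fin n} → (∀ x → ℓ′ (f x) ≡ ℓ x) →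
                IsKind ℓ t → IsKind ℓ′ (rename f t)
IsKind-rename h sort    = sort
IsKind-rename h (Π A K) = Π (Low-rename h A) (IsKind-rename (liftᵣ-level h) K)

Sorted-weaken : Sorted ℓ t A → Sorted (l ◂ ℓ) (weaken t) (weaken A)
Sorted-weaken (object t A) =
  object (Low-rename (λ _ → refl) t) (Low-rename (λ _ → refl) A)
Sorted-weaken (family t A) =
  family (Low-rename (λ _ → refl) t) (IsKind-rename (λ _ → refl) A)
Sorted-weaken (kind t) = kind (IsKind-rename (λ _ → refl) t)

liftₛ-level : {σ : Fin m → Term n} → (∀ x → Low ℓ′ (ℓ x) (σ x)) →
              ∀ x → Low (l ◂ ℓ′) ((l ◂ ℓ) x) (liftₛ σ x)
liftₛ-level h zero    = var refl
liftₛ-level h (suc x) = Low-rename (λ _ → refl) (h x)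

Low-subst : {σ : Fin m → Term n} → (∀ x → Low ℓ′ (ℓ x) (σ x)) →
            Low ℓ l t → Low ℓ′ l (t ⟪ σ ⟫)
Low-subst h (var refl) = h _
Low-subst h (Π A B)    = Π (Low-subst h A) (Low-subst (liftₛ-level h) B)
Low-subst h (ƛ A t)    = ƛ (Low-subst h A) (Low-subst (liftₛ-level h) t)
Low-subst h (t · u)    = Low-subst h t · Low-subst h u

IsKind-subst : {σ : Fin m → Term n} → (∀ x → Low ℓ′ (ℓ x) (σ x)) →
               IsKind ℓ t → IsKind ℓ′ (t ⟪ σ ⟫)
IsKind-subst h sort    = sort
IsKind-subst h (Π A K) = Π (Low-subst h A) (IsKind-subst (liftₛ-level h) K)

[]-level : Low ℓ obj u → ∀ x → Low ℓ ((obj ◂ ℓ) x) (insertAt var zero u x)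
[]-level u zero    = u
[]-level u (suc x) = var refl

-- The level of a variable declared with this term as its type: a family if the term ends in a sort.
-- It is read off the raw term because D¹, which depends on it, has to be defined on raw terms.
varLevel : Term n → Level
varLevel (sort _) = fam
varLevel (Π _ B)  = varLevel B
varLevel _        = obj

Low⇒varLevel : Low ℓ l A → varLevel A ≡ obj
Low⇒varLevel (var _) = refl
Low⇒varLevel (Π _ B) = Low⇒varLevel B
Low⇒varLevel (ƛ _ _) = refl
Low⇒varLevel (_ · _) = refl

IsKind⇒varLevel : IsKind ℓ A → varLevel A ≡ fam
IsKind⇒varLevel sort    = refl
IsKind⇒varLevel (Π _ K) = IsKind⇒varLevel K

varLevel-rename : {f : Fin m → Fin n} (A : Term m) →
                  varLevel (rename f A) ≡ varLevel A
varLevel-rename (var _)  = refl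
varLevel-rename (sort _) = refl
varLevel-rename (Π _ B)  = varLevel-rename B
varLevel-rename (ƛ _ _)  = refl
varLevel-rename (_ · _)  = refl

levels : Ext 0 n → Fin n → Level
levels (Γ ▹ A) = varLevel A ◂ levels Γ

levels-∋ : ∀ {Γ : Ext 0 n} {x A} → Γ ∋ x ∶ A → levels Γ x ≡ varLevel A
levels-∋ (here {A = A})    = sym (varLevel-rename A)
levels-∋ (there {A = A} x) = trans (levels-∋ x) (sym (varLevel-rename A))

Classified : Ext 0 n → Set
Classified Γ = ∀ {x A} → Γ ∋ x ∶ A → Sorted (levels Γ) (var x) A

Sorted-declare : ∀ {s} → Sorted ℓ A (sort s) → Sorted (varLevel A ◂ ℓ) (var zero) (weaken A)
Sorted-declare (family A _) = object (var (Low⇒varLevel A)) (Low-rename (λ _ → refl) A)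
Sorted-declare (kind A)     = family (var (IsKind⇒varLevel A)) (IsKind-rename (λ _ → refl) A)

Classified-▹ : ∀ {Γ : Ext 0 n} {s} → Classified Γ → Sorted (levels Γ) A (sort s) →
               Classified (Γ ▹ A)
Classified-▹ Γ A here      = Sorted-declare A
Classified-▹ Γ A (there x) = Sorted-weaken (Γ x)

Sorted-Type : Sorted ℓ A (sort Type) → Low ℓ fam A
Sorted-Type (family A _) = A

Sorted-fam : Low ℓ fam A → Sorted ℓ t A → Low ℓ obj t
Sorted-fam A (object t _) = t
Sorted-fam A (family _ K) = ⊥-elim (Low⇒¬IsKind A K)

Sorted-varLevel : Sorted ℓ t A → Sorted ℓ u A → varLevel t ≡ varLevel u
Sorted-varLevel (kind t)     (kind u)     =
  trans (IsKind⇒varLevel t) (sym (IsKind⇒varLevel u))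
Sorted-varLevel (object t _) (object u _) = trans (Low⇒varLevel t) (sym (Low⇒varLevel u))
Sorted-varLevel (object t _) (family u _) = trans (Low⇒varLevel t) (sym (Low⇒varLevel u))
Sorted-varLevel (family t _) (object u _) = trans (Low⇒varLevel t) (sym (Low⇒varLevel u))
Sorted-varLevel (family t _) (family u _) = trans (Low⇒varLevel t) (sym (Low⇒varLevel u))

-- The common sort `s` decides whether both sides are types or both are kinds, so the subject stays
-- in its stratum.
Sorted-conv : ∀ {s} → Sorted ℓ A (sort s) → Sorted ℓ B (sort s) →
              Sorted ℓ t A → Sorted ℓ t B
Sorted-conv (family A _) (family B _) (object t _) = object t B
Sorted-conv (family A _) B            (family t K) = ⊥-elim (Low⇒¬IsKind A K)
Sorted-conv (kind K)     B            (object t A) = ⊥-elim (Low⇒¬IsKind A K)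
Sorted-conv (kind _)     (kind K)     (family t _) = family t K
Sorted-conv (object () _) B           (kind _)
Sorted-conv (family () _) B           (kind _)
Sorted-conv (kind ())     B           (kind _)

under : ∀ {s} → Low ℓ fam A → Sorted (varLevel A ◂ ℓ) t s → Sorted (obj ◂ ℓ) t s
under {ℓ = ℓ} A t = subst (λ l → Sorted (l ◂ ℓ) _ _) (Low⇒varLevel A) t

Sorted-Π : ∀ {s} → Low ℓ fam A → Sorted (obj ◂ ℓ) B (sort s) →
           Sorted ℓ (Π A B) (sort s)
Sorted-Π A (family B sort) = family (Π A B) sort
Sorted-Π A (kind B)        = kind (Π A B)

Sorted-ƛ : ∀ {s} → Low ℓ fam A → Sorted (obj ◂ ℓ) B (sort s) →
           Sorted (obj ◂ ℓ) t B → Sorted ℓ (ƛ A t) (Π A B)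
Sorted-ƛ A _ (object t B) = object (ƛ A t) (Π A B)
Sorted-ƛ A _ (family t B) = family (ƛ A t) (Π A B)
Sorted-ƛ A (object () _) (kind _)
Sorted-ƛ A (family () _) (kind _)
Sorted-ƛ A (kind ())     (kind _)

Sorted-app : Sorted ℓ t (Π A B) → Sorted ℓ u A → Sorted ℓ (t · u) (B [ u ])
Sorted-app (object t (Π A B)) u =
  let u′ = Sorted-fam A u in object (t · u′) (Low-subst ([]-level u′) B)
Sorted-app (family t (Π A B)) u =
  let u′ = Sorted-fam A u in family (t · u′) (IsKind-subst ([]-level u′) B)

module Classification {k} (Σ : Ext 0 k) (R : Pred (Rule k) 0ℓ)
                      (Σ-classified : Classified Σ) where

  open Modulo Σ R

  ⊢-context : ∀ {n} {Γ : Ext k n} {t A} → Γ ⊢ t ∶ A → ⊢ Γ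
  ⊢-context (⊢sort Γ)        = Γ
  ⊢-context (⊢var Γ _)       = Γ
  ⊢-context (⊢Π _ A _)       = ⊢-context A
  ⊢-context (⊢ƛ _ A _ _)     = ⊢-context A
  ⊢-context (⊢app t _)       = ⊢-context t
  ⊢-context (⊢conv _ A _ _ _) = ⊢-context A

  private
    ⊢⇒Classified′ : ∀ {n} {Γ : Ext k n} → ⊢ Γ → Classified (Σ ++ Γ)
    -- The context is classified along with the term because a context extracted by `⊢-context` is
    -- not structurally smaller than the derivation it comes from.
    classify′ : ∀ {n} {Γ : Ext k n} {t A} → Γ ⊢ t ∶ A →
                Classified (Σ ++ Γ) × Sorted (levels (Σ ++ Γ)) t A
    ⊢⇒Classified′ empty         = Σ-classified
    ⊢⇒Classified′ (declare s A) =
      let Γ , A′ = classify′ A in Classified-▹ Γ A′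
    classify′ (⊢sort Γ)  = ⊢⇒Classified′ Γ , kind sort
    classify′ (⊢var Γ x) = let Γ′ = ⊢⇒Classified′ Γ in Γ′ , Γ′ x
    classify′ (⊢Π s A B) =
      let Γ , A∶ = classify′ A
          A′     = Sorted-Type A∶
          _ , B′ = classify′ B
      in Γ , Sorted-Π A′ (under A′ B′)
    classify′ (⊢ƛ s A B t) =
      let Γ , A∶ = classify′ A
          A′     = Sorted-Type A∶
          _ , B′ = classify′ B
          _ , t′ = classify′ t
      in Γ , Sorted-ƛ A′ (under A′ B′) (under A′ t′)
    classify′ (⊢app t u) =
      let Γ , t′ = classify′ t
          _ , u′ = classify′ u
      in Γ , Sorted-app t′ u′
    classify′ (⊢conv s A B t A≡B) =
      let Γ , A′ = classify′ A
          _ , B′ = classify′ B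
          _ , t′ = classify′ t
      in Γ , Sorted-conv A′ B′ t′

  ⊢⇒Classified : ∀ {n} {Γ : Ext k n} → ⊢ Γ → Classified (Σ ++ Γ)
  ⊢⇒Classified = ⊢⇒Classified′

  classify : ∀ {n} {Γ : Ext k n} {t A} → Γ ⊢ t ∶ A → Sorted (levels (Σ ++ Γ)) t A
  classify t = proj₂ (classify′ t)

-- Constants and erasure

Ext⇒≤ : Ext k n → k ≤ n
Ext⇒≤ []      = ≤-refl
Ext⇒≤ (Γ ▹ _) = m≤n⇒m≤1+n (Ext⇒≤ Γ)

toℕ-base : (Γ : Ext k n) (c : Fin k) → toℕ (base Γ c) + k ≡ toℕ c + n
toℕ-base []                c = refl
toℕ-base {n = suc n} (Γ ▹ _) c = trans (cong suc (toℕ-base Γ c)) (sym (+-suc (toℕ c) n))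

-- A root step locates the constants through a context `Δ` of its own; this identifies them with the
-- constants below the ambient context.
base-unique : (Γ Δ : Ext k n) (c : Fin k) → base Γ c ≡ base Δ c
base-unique {k} Γ Δ c = toℕ-injective
  (+-cancelʳ-≡ k _ _ (trans (toℕ-base Γ c) (sym (toℕ-base Δ c))))

∋⇒base⊎∋ : ∀ {Σ : Ext 0 k} {Γ : Ext k n} {x A} → Σ ++ Γ ∋ x ∶ A →
           (∃ λ c → x ≡ base Γ c) ⊎ Γ ∋ x ∶ A
∋⇒base⊎∋ {Γ = []}    {x} _ = inj₁ (x , refl)
∋⇒base⊎∋ {Γ = Γ ▹ _} here = inj₂ here
∋⇒base⊎∋ {Γ = Γ ▹ _} (there x) with ∋⇒base⊎∋ {Γ = Γ} x
... | inj₁ (c , refl) = inj₁ (c , refl)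
... | inj₂ x′         = inj₂ (there x′)

base⊎∋ : (Γ : Ext k n) (x : Fin n) → (∃ λ c → x ≡ base Γ c) ⊎ (∃ λ A → Γ ∋ x ∶ A)
base⊎∋ []      x       = inj₁ (x , refl)
base⊎∋ (Γ ▹ A) zero    = inj₂ (_ , here)
base⊎∋ (Γ ▹ A) (suc x) with base⊎∋ Γ x
... | inj₁ (c , refl) = inj₁ (c , refl)
... | inj₂ (A′ , x′)  = inj₂ (_ , there x′)

declared : (Γ : Ext 0 n) → ∀ x → ∃ λ A → Γ ∋ x ∶ A
declared Γ x with base⊎∋ Γ x
... | inj₂ x′ = x′

∋⇒< : ∀ {Γ : Ext k n} {x A} → Γ ∋ x ∶ A → toℕ x + k < n
∋⇒< (here {Γ = Γ}) = s≤s (Ext⇒≤ Γ)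
∋⇒< (there x)      = s≤s (∋⇒< x)

∌base : ∀ {Γ : Ext k n} {c A} → ¬ Γ ∋ base Γ c ∶ A
∌base {n = n} {Γ = Γ} {c} x =
  <-irrefl refl (≤-trans (∋⇒< x) (≤-trans (m≤n+m n (toℕ c)) (≤-reflexive (sym (toℕ-base Γ c)))))

-- In a scope of at least k variables, the outermost k are the constants.

constant? : ∀ {n} → Fin n → Maybe (Fin k)
constant? {k} {suc n} zero with n <? k
... | yes n<k = just (opposite (fromℕ< n<k))
... | no _    = nothing
constant? {n = suc n} (suc x) = constant? x

constant?-just : ∀ {n} (x : Fin n) (c : Fin k) → toℕ x + k ≡ toℕ c + n →
                 constant? x ≡ just c
constant?-just {k} {suc n} zero c e with n <? k
... | yes n<k = cong just (toℕ-injective (trans (opposite-prop (fromℕ< n<k))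
      (trans (cong (λ i → k ∸ suc i) (toℕ-fromℕ< n<k))
      (trans (cong (_∸ suc n) e) (m+n∸n≡m (toℕ c) (suc n))))))
... | no n≮k  = ⊥-elim (n≮k (subst (suc n ≤_) (sym e) (m≤n+m (suc n) (toℕ c))))
constant?-just {n = suc n} (suc x) c e =
  constant?-just x c (suc-injective (trans e (+-suc (toℕ c) n)))

constant?-nothing : ∀ {n} (x : Fin n) → toℕ x + k < n → constant? {k} x ≡ nothing
constant?-nothing {k} {suc n} zero k<n with n <? k
... | yes n<k = ⊥-elim (≤⇒≯ (s≤s⁻¹ k<n) n<k)
... | no _    = refl
constant?-nothing (suc x) (s≤s h) = constant?-nothing x h

-- Constants are recognised by their distance from the outer end of the scope, which is unaffected
-- by a variable inserted further inside.
constant?-punchIn : ∀ {n} (x : Fin (suc n)) → toℕ x + k < suc n → (y : Fin n) →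
                    constant? {k} (punchIn x y) ≡ constant? y
constant?-punchIn zero    _ y       = refl
constant?-punchIn {k} {suc n} (suc x) (s≤s h) zero =
  trans (constant?-nothing {k} {suc (suc n)} zero (s≤s k≤))
        (sym (constant?-nothing {k} {suc n} zero k≤′))
  where
  k≤′ : k < suc n
  k≤′ = ≤-trans (s≤s (m≤n+m k (toℕ x))) h
  k≤ : k ≤ suc n
  k≤ = ≤-trans (m≤n⇒m≤1+n ≤-refl) k≤′
constant?-punchIn (suc x) (s≤s h) (suc y) = constant?-punchIn x h y

-- Validity leaves a valuation unconstrained at the constants, so fixed values overwrite it there.
-- An interpretation sees no context, hence the position in the scope has to tell which variables
-- are constants.
withConstants : ∀ {n} → (Fin k → V) → Valuation n → Fin n → V
withConstants v φ x = maybe′ v (φ x) (constant? x)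

module _ (v : Fin k → V) (φ : Valuation n) where

  withConstants-base : (Γ : Ext k n) → ∀ c → withConstants v φ (base Γ c) ≡ v c
  withConstants-base Γ c =
    cong (maybe′ v _) (constant?-just (base Γ c) c (toℕ-base Γ c))

  withConstants-∋ : ∀ {Γ : Ext k n} {x A} → Γ ∋ x ∶ A → withConstants v φ x ≡ φ x
  withConstants-∋ {x = x} ∋x = cong (maybe′ v (φ x)) (constant?-nothing x (∋⇒< ∋x))

-- fun a one denotes the same set as one. Since arr never yields it, arr a b
-- determines a and b unless b is one.

data Code : Set where
  one prop : Code
  fun      : Code → Code → Code

arr : Code → Code → Code
arr a one        = one
arr a prop       = fun a prop
arr a (fun b b′) = fun a (fun b b′)

arr-injective : ∀ {a a′} b b′ → arr a b ≡ arr a′ b′ → b ≡ one ⊎ (a ≡ a′ × b ≡ b′)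
arr-injective one       _          _    = inj₁ refl
arr-injective prop      prop       refl = inj₂ (refl , refl)
arr-injective (fun _ _) (fun _ _)  refl = inj₂ (refl , refl)

arr≡fun : ∀ {a c d} b → arr a b ≡ fun c d → a ≡ c × b ≡ d
arr≡fun prop      refl = refl , refl
arr≡fun (fun _ _) refl = refl , refl

-- Sorts erase to `prop` because their carrier is the algebra; `one` at binders is the code shared
-- by all objects, matching their value `∅`.
open Fold (isEquivalence {A = Code}) prop arr (cong₂ arr) one using () renaming
  (fold to erase; fold-weaken to erase-weaken; fold-[] to erase-[])

erase-object : ∀ {ℓ : Fin n → Level} {γ t} → (∀ x → ℓ x ≡ obj → γ x ≡ one) →
               Low ℓ obj t → erase t γ ≡ one
erase-object h (var e) = h _ e
erase-object h (ƛ _ t) = erase-object (λ { zero _ → refl ; (suc x) → h x }) t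
erase-object h (t · _) = erase-object h t

⌊_⌋ : SimpleType → Code
⌊ ι ⌋     = one
⌊ o ⌋     = prop
⌊ A ⇒ B ⌋ = arr ⌊ A ⌋ ⌊ B ⌋

erase-type : ∀ {i p} {γ : Fin n → Code} → γ i ≡ one → γ p ≡ prop → ∀ A →
             erase (type i p A) γ ≡ ⌊ A ⌋
erase-type γi γp ι       = γi
erase-type γi γp o       = γp
erase-type {i = i} {p} γi γp (A ⇒ B) = cong₂ arr (erase-type γi γp A)
  (trans (sym (erase-weaken (type i p B))) (erase-type γi γp B))

rename-type : (ρ : Fin m → Fin n) → ∀ {i p} A →
              rename ρ (type i p A) ≡ type (ρ i) (ρ p) A
weaken-type : ∀ {i p : Fin n} A → weaken (type i p A) ≡ type (suc i) (suc p) A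
rename-type ρ ι       = refl
rename-type ρ o       = refl
rename-type ρ (A ⇒ B) = cong₂ Π (rename-type ρ A)
  (trans (cong (rename (liftᵣ ρ)) (weaken-type B))
  (trans (rename-type (liftᵣ ρ) B) (sym (weaken-type B))))
weaken-type ι       = refl
weaken-type o       = refl
weaken-type (A ⇒ B) = cong₂ Π (weaken-type A)
  (trans (cong (rename (liftᵣ suc)) (weaken-type B))
  (trans (rename-type (liftᵣ suc) B) (sym (weaken-type B))))

data Constant : Set where
  iota omicron implies holds : Constant
  forAll : SimpleType → Constant

decodeₖ : (As : List SimpleType) → Fin (length As + 3) → Constant
decodeₖ []       0F      = implies
decodeₖ []       1F      = omicron
decodeₖ []       2F      = iota
decodeₖ (A ∷ As) zero    = forAll A
decodeₖ (A ∷ As) (suc c) = decodeₖ As c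

typeOf : (i p : Fin n) → Constant → Term n
typeOf i p iota       = sort Type
typeOf i p omicron    = sort Type
typeOf i p implies    = type i p (o ⇒ o ⇒ o)
typeOf i p holds      = var p ⟶ sort Type
typeOf i p (forAll A) = type i p ((A ⇒ o) ⇒ o)

weaken-typeOf : ∀ {i p : Fin n} c → weaken (typeOf i p c) ≡ typeOf (suc i) (suc p) c
weaken-typeOf iota       = refl
weaken-typeOf omicron    = refl
weaken-typeOf implies    = refl
weaken-typeOf holds      = refl
weaken-typeOf (forAll A) = weaken-type ((A ⇒ o) ⇒ o)

decodeₖ-type : ∀ As {c A} → connectives ++ quantifiers As ∋ c ∶ A →
               A ≡ typeOf (length As ↑ʳ 2F) (length As ↑ʳ 1F) (decodeₖ As c)
decodeₖ-type [] here                 = refl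
decodeₖ-type [] (there here)         = refl
decodeₖ-type [] (there (there here)) = refl
decodeₖ-type (A ∷ As) here           = weaken-type ((A ⇒ o) ⇒ o)
decodeₖ-type (A ∷ As) (there {x = c} ∋c) =
  trans (cong weaken (decodeₖ-type As ∋c)) (weaken-typeOf (decodeₖ As c))

-- `one` plays three parts: for `holds` it gives both sides of each rule the same code, for `iota`
-- it is a choice of carrier, and for `implies` and `forAll` it is the default of objects.
constantCode typeCode : Constant → Code
constantCode omicron = prop
constantCode _       = one
typeCode iota       = prop
typeCode omicron    = prop
typeCode implies    = ⌊ o ⇒ o ⇒ o ⌋
typeCode holds      = fun prop prop
typeCode (forAll A) = ⌊ (A ⇒ o) ⇒ o ⌋

erase-typeOf : ∀ {i p} {γ : Fin n → Code} → γ i ≡ one → γ p ≡ prop → ∀ c →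
               erase (typeOf i p c) γ ≡ typeCode c
erase-typeOf γi γp iota       = refl
erase-typeOf γi γp omicron    = refl
erase-typeOf {γ = γ} γi γp implies    = erase-type {γ = γ} γi γp (o ⇒ o ⇒ o)
erase-typeOf γi γp holds      = cong (λ a → fun a prop) γp
erase-typeOf {γ = γ} γi γp (forAll A) = erase-type {γ = γ} γi γp ((A ⇒ o) ⇒ o)

-- The constants of simple type theory, and erasure under reduction

module Constants (As : List SimpleType) where

  open STT As renaming (k to #constants)

  decode : Fin #constants → Constant
  decode zero    = holds
  decode (suc c) = decodeₖ As c

  decode-type : ∀ {c A} → constants ∋ c ∶ A → A ≡ typeOf cι co (decode c)
  decode-type here                  = refl
  decode-type (there {x = c} ∋c) =
    trans (cong weaken (decodeₖ-type As ∋c)) (weaken-typeOf (decodeₖ As c))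

  decode-ι : decode cι ≡ iota
  decode-ι = lem As
    where
    lem : ∀ As → decodeₖ As (length As ↑ʳ 2F) ≡ iota
    lem []       = refl
    lem (_ ∷ As) = lem As

  decode-o : decode co ≡ omicron
  decode-o = lem As
    where
    lem : ∀ As → decodeₖ As (length As ↑ʳ 1F) ≡ omicron
    lem []       = refl
    lem (_ ∷ As) = lem As

  decode-⇒ : decode c⇒ ≡ implies
  decode-⇒ = lem As
    where
    lem : ∀ As → decodeₖ As (length As ↑ʳ 0F) ≡ implies
    lem []       = refl
    lem (_ ∷ As) = lem As

  decode-∀ : ∀ {A} (A∈ : A ∈ₗ As) → decode (c∀ A∈) ≡ forAll A
  decode-∀ = lem
    where
    lem : ∀ {A As} (A∈ : A ∈ₗ As) → decodeₖ As (index A∈ ↑ˡ 3) ≡ forAll A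
    lem (here refl) = refl
    lem (there A∈)  = lem A∈

  -- The constants form an ordinary context of the plain calculus, so the classification over the
  -- empty theory applies to them.
  constants-classified : Classified constants
  constants-classified = subst Classified ([]++ constants)
    (Classification.⊢⇒Classified [] (λ _ → ⊥) (λ ()) (Theory.wellFormed (simpleTypeTheory As)))
    where
    []++ : ∀ {n} (Γ : Ext 0 n) → [] ++ Γ ≡ Γ
    []++ []      = refl
    []++ (Γ ▹ A) = cong (_▹ A) ([]++ Γ)

  open Modulo constants Rules public
  open Classification constants Rules constants-classified public

  -- Both sides have code `one`: the left one is an application headed by `ε`, and the right one a
  -- product whose codomain is such an application, which `arr` collapses.
  erase-root : ∀ {n} (Γ : Ext #constants n) {γ t t′} → γ (base Γ cε) ≡ one →
               Root Rules t t′ → erase t γ ≡ erase t′ γ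
  erase-root Γ {γ} γε (fire implication Δ θ θ≡) =
    trans ε≡one (sym (cong (arr _) (trans (sym (erase-weaken (θ 2F))) ε≡one)))
    where
    ε≡one : erase (θ 2F) γ ≡ one
    ε≡one = trans (cong (λ t → erase t γ) (trans (θ≡ cε) (cong var (base-unique Δ Γ cε)))) γε
  erase-root Γ {γ} γε (fire (universal A∈) Δ θ θ≡) =
    trans ε≡one (sym (cong (arr _) (trans (sym (erase-weaken (θ 1F))) ε≡one)))
    where
    ε≡one : erase (θ 1F) γ ≡ one
    ε≡one = trans (cong (λ t → erase t γ) (trans (θ≡ cε) (cong var (base-unique Δ Γ cε)))) γε

  under-one : ∀ {n} {ℓ : Fin n → Level} {γ} → (∀ x → ℓ x ≡ obj → γ x ≡ one) →
              ∀ x → (obj ◂ ℓ) x ≡ obj → (one ◂ γ) x ≡ one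
  under-one h zero    _ = refl
  under-one h (suc x)   = h x

  -- In a classified redex the argument is an object, so its code is the default `one` that the
  -- binder assigned.
  erase-low : ∀ {n} (Γ : Ext #constants n) {ℓ γ t t′ l} →
              (∀ x → ℓ x ≡ obj → γ x ≡ one) → γ (base Γ cε) ≡ one →
              Low ℓ l t → t ⟶¹ t′ → erase t γ ≡ erase t′ γ
  erase-low Γ h γε t (root (inj₂ r)) = erase-root Γ γε r
  erase-low Γ h γε (ƛ {t = t} _ _ · u) (root (inj₁ beta)) =
    erase-[] t (erase-object h u)
  erase-low Γ h γε (Π A B) (Πˡ r) = cong (λ a → arr a _) (erase-low Γ h γε A r)
  erase-low Γ h γε (Π {A = A} _ B) (Πʳ r) =
    cong (arr _) (erase-low (Γ ▹ A) (under-one h) γε B r)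
  erase-low Γ h γε (ƛ A t) (ƛˡ r) = refl
  erase-low Γ h γε (ƛ {A = A} _ t) (ƛʳ r) = erase-low (Γ ▹ A) (under-one h) γε t r
  erase-low Γ h γε (t · u) (appˡ r) = erase-low Γ h γε t r
  erase-low Γ h γε (t · u) (appʳ r) = refl

  erase-kind : ∀ {n} (Γ : Ext #constants n) {ℓ γ t t′} →
              (∀ x → ℓ x ≡ obj → γ x ≡ one) → γ (base Γ cε) ≡ one →
              IsKind ℓ t → t ⟶¹ t′ → erase t γ ≡ erase t′ γ
  erase-kind Γ h γε t (root (inj₂ r)) = erase-root Γ γε r
  erase-kind Γ h γε sort (root (inj₁ ()))
  erase-kind Γ h γε (Π A B) (Πˡ r) = cong (λ a → arr a _) (erase-low Γ h γε A r)
  erase-kind Γ h γε (Π {A = A} _ B) (Πʳ r) =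
    cong (arr _) (erase-kind (Γ ▹ A) (under-one h) γε B r)

-- The algebra-valued interpretation

module Interpret (𝓑-algebra : ΠAlgebra) (full : Full 𝓑-algebra) where

  open ΠAlgebra 𝓑-algebra renaming (_≤_ to _≤̃_)
  open IsPreorder isPreorder using () renaming
    (refl to ⊑-refl; trans to ⊑-trans; reflexive to ⊑-reflexive)

  -- pi extends Π̃ to all sets, by ∅ outside its domain.

  record Domain (a S : V) : Set where
    field
      argument∊ : a ∊ 𝓑
      family∊   : ∀ i → elem S i ∊ 𝓑
      inhabited : Index S

    family∈𝓐 : 𝓐 S
    family∈𝓐 = full
      (λ z∈ → let at j e = ∈⇒∊ {y = S} z∈ in ∊⇒∈ (∊-respˡ (≋-sym e) (family∊ j)))
      (elem S inhabited , ∊⇒∈ (elem∊ S inhabited))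

    product : Element 𝓑
    product = Π̃ ⟨ a , ∊⇒∈ argument∊ ⟩ (S , family∈𝓐)

  open Domain

  product-cong : ∀ {a a′ S S′} → a ≋ a′ → S ≋ S′ → (d : Domain a S) (d′ : Domain a′ S′) →
                 value (product d) ≋ value (product d′)
  product-cong a≋ S≋ d d′ = equal (Π̃-cong (≋⇒≐ a≋) (≋⇒≐ S≋))

  Domain-resp : ∀ {a a′ S S′} → a ≋ a′ → S ≋ S′ → Domain a S → Domain a′ S′
  Domain-resp a≋ S≋ d = record
    { argument∊ = ∊-respˡ a≋ (argument∊ d)
    ; family∊   = λ j → let at i e = ≋⇒elem∊ (≋-sym S≋) j
                        in ∊-respˡ (≋-sym e) (family∊ d i)
    ; inhabited = position (≋⇒elem∊ S≋ (inhabited d))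
    }

  opaque

    -- Indexing by proofs of `Domain a S` avoids deciding membership: without a proof the set is
    -- empty, and any two proofs contribute the same elements by `product-cong`.
    pi : V → V → V
    pi a S = sup (∃ λ (d : Domain a S) → Index (value (product d)))
                 (λ (d , i) → elem (value (product d)) i)

    pi-product : ∀ {a S} (d : Domain a S) → pi a S ≋ value (product d)
    pi-product d = ≋-ext
      (λ (d′ , i) → ≋⇒elem∊ (product-cong ≋-refl ≋-refl d′ d) i)
      (λ i → at (d , i) ≋-refl)

    ∊pi⇒Domain : ∀ {a S z} → z ∊ pi a S → Domain a S
    ∊pi⇒Domain (at (d , _) _) = d

  pi-value : ∀ {a S} → Index S → (a∈ : a ∈ 𝓑) (S∈ : 𝓐 S) →
             pi a S ≋ value (Π̃ ⟨ a , a∈ ⟩ (S , S∈))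
  pi-value {a} {S} i a∈ S∈ = ≋-trans
    (pi-product record
      { argument∊ = ∈⇒∊ a∈
      ; family∊   = λ j → ∈⇒∊ (𝓐-subset S∈ (∊⇒∈ (elem∊ S j)))
      ; inhabited = i
      })
    (equal (Π̃-cong (≐-refl a) (≐-refl S)))

  pi∊ : ∀ {a S} → a ∊ 𝓑 → (∀ i → elem S i ∊ 𝓑) → Index S → pi a S ∊ 𝓑
  pi∊ {a} {S} a∊ S∊ i = ∊-respˡ (≋-sym (pi-product d)) (∈⇒∊ (value∈ (product d)))
    where
    d : Domain a S
    d = record { argument∊ = a∊ ; family∊ = S∊ ; inhabited = i }

  pi-mono : ∀ {a a′ S S′ z} → a ≋ a′ → S ≋ S′ → z ∊ pi a S → z ∊ pi a′ S′
  pi-mono {a} {a′} {S} {S′} a≋ S≋ z∊ = ∊-respʳ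
    (≋-trans (pi-product d) (≋-trans (product-cong a≋ S≋ d d′) (≋-sym (pi-product d′)))) z∊
    where
    d : Domain a S
    d = ∊pi⇒Domain z∊
    d′ : Domain a′ S′
    d′ = Domain-resp a≋ S≋ d

  pi-cong : ∀ {a a′ S S′} → a ≋ a′ → S ≋ S′ → pi a S ≋ pi a′ S′
  pi-cong a≋ S≋ =
    ≋-ext-∊ (λ _ → pi-mono a≋ S≋) (λ _ → pi-mono (≋-sym a≋) (≋-sym S≋))

  -- Codes as sets, and the interpretations of terms in them

  El : Code → V
  El one       = single ∅
  El prop      = 𝓑
  El (fun a b) = Fun (El a) (El b)

  El-arr : ∀ a b → El (arr a b) ≋ Fun (El a) (El b)
  El-arr a one       = ≋-sym Fun-single-∅
  El-arr a prop      = ≋-refl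
  El-arr a (fun _ _) = ≋-refl

  -- `Π̃` accepts non-empty sets only, and the family of a product is indexed by the carrier of its
  -- domain.
  El-inhabited : ∀ c → Index (El c)
  El-inhabited one       = tt
  El-inhabited prop      = proj₁ (value∈ ⊤̃)
  El-inhabited (fun a b) = position
    (∊-Fun⁺ {X = El a} {Y = El b} {h = λ _ → elem (El b) (El-inhabited b)}
            (λ _ _ _ → ≋-refl) (λ _ → elem∊ _ _))

  open Fold ≋-isEquivalence 𝓑 Fun Fun-cong ∅ public using () renaming
    ( fold to ∣_∣; fold-rename to ∣∣-rename; fold-weaken to ∣∣-weaken
    ; fold-subst to ∣∣-subst)

  -- `φ` holds the D³-values of the variables; `ρ` holds their D²-values and serves only to find the
  -- carriers over which binders range.
  value-of : ∀ {n} → Term n → (ρ φ : Fin n → V) → V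
  value-of (var x)  ρ φ = φ x
  value-of (sort _) ρ φ = value ⊤̃
  value-of (Π C E)  ρ φ = pi (value-of C ρ φ)
    (image (∣ C ∣ ρ) λ i → value-of E (∅ ◂ ρ) (elem (∣ C ∣ ρ) i ◂ φ))
  value-of (ƛ C t)  ρ φ =
    lam (∣ C ∣ ρ) λ i → value-of t (∅ ◂ ρ) (elem (∣ C ∣ ρ) i ◂ φ)
  value-of (t · u)  ρ φ = app (value-of t ρ φ) (value-of u ρ φ)

  value-rename : ∀ {m n} {f : Fin m → Fin n} {ρ ρ′ φ φ′} t →
    (∀ x → x FreeIn t → ρ x ≋ ρ′ (f x)) → (∀ x → x FreeIn t → φ x ≋ φ′ (f x)) →
    value-of t ρ φ ≋ value-of (rename f t) ρ′ φ′
  value-rename (var x)  h h′ = h′ x var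
  value-rename (sort _) h h′ = ≋-refl
  value-rename (Π C E)  h h′ = pi-cong
    (value-rename C (λ x → h x ∘ Πˡ) (λ x → h′ x ∘ Πˡ))
    (image-cong (∣∣-rename C λ x → h x ∘ Πˡ) λ i j e → value-rename E
      (λ { zero _ → ≋-refl ; (suc x) → h x ∘ Πʳ })
      (λ { zero _ → e ; (suc x) → h′ x ∘ Πʳ }))
  value-rename (ƛ C t)  h h′ =
    lam-cong (∣∣-rename C λ x → h x ∘ ƛˡ) λ i j e → value-rename t
      (λ { zero _ → ≋-refl ; (suc x) → h x ∘ ƛʳ })
      (λ { zero _ → e ; (suc x) → h′ x ∘ ƛʳ })
  value-rename (t · u)  h h′ = app-cong
    (value-rename t (λ x → h x ∘ appˡ) (λ x → h′ x ∘ appˡ))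
    (value-rename u (λ x → h x ∘ appʳ) (λ x → h′ x ∘ appʳ))

  value-weaken : ∀ {n} {v w} {ρ φ : Fin n → V} t →
                 value-of t ρ φ ≋ value-of (weaken t) (v ◂ ρ) (w ◂ φ)
  value-weaken t = value-rename t (λ _ _ → ≋-refl) (λ _ _ → ≋-refl)

  value-cong : ∀ {n} {ρ ρ′ φ φ′ : Fin n → V} t → (∀ x → ρ x ≋ ρ′ x) →
               (∀ x → φ x ≋ φ′ x) → value-of t ρ φ ≋ value-of t ρ′ φ′
  value-cong {ρ = ρ} {ρ′} {φ} {φ′} t h h′ =
    subst (λ t′ → value-of t ρ φ ≋ value-of t′ ρ′ φ′) (rename-id (λ _ → refl) t)
          (value-rename t (λ x _ → h x) (λ x _ → h′ x))

  value-cong-◂ : ∀ {n} {ρ φ : Fin n → V} {v w} t → v ≋ w →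
                 value-of t (∅ ◂ ρ) (v ◂ φ) ≋ value-of t (∅ ◂ ρ) (w ◂ φ)
  value-cong-◂ t e = value-cong t (λ _ → ≋-refl)
    λ { zero → e ; (suc _) → ≋-refl }

  value-subst : ∀ {m n} {σ : Fin m → Term n} {ρ ρ′ φ φ′} t →
    (∀ x → ρ x ≋ ∣ σ x ∣ ρ′) → (∀ x → φ x ≋ value-of (σ x) ρ′ φ′) →
    value-of t ρ φ ≋ value-of (t ⟪ σ ⟫) ρ′ φ′
  value-subst-liftₛ : ∀ {m n} {σ : Fin m → Term n} {ρ ρ′ φ φ′ v v′} t →
    (∀ x → ρ x ≋ ∣ σ x ∣ ρ′) → (∀ x → φ x ≋ value-of (σ x) ρ′ φ′) → v ≋ v′ →
    value-of t (∅ ◂ ρ) (v ◂ φ) ≋ value-of (t ⟪ liftₛ σ ⟫) (∅ ◂ ρ′) (v′ ◂ φ′)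
  value-subst (var x)  h h′ = h′ x
  value-subst (sort _) h h′ = ≋-refl
  value-subst (Π C E)  h h′ = pi-cong (value-subst C h h′)
    (image-cong (∣∣-subst C h) λ i j → value-subst-liftₛ E h h′)
  value-subst (ƛ C t)  h h′ =
    lam-cong (∣∣-subst C h) λ i j → value-subst-liftₛ t h h′
  value-subst (t · u)  h h′ = app-cong (value-subst t h h′) (value-subst u h h′)
  value-subst-liftₛ {σ = σ} t h h′ e = value-subst t
    (λ { zero → ≋-refl ; (suc x) → ≋-trans (h x) (∣∣-weaken (σ x)) })
    (λ { zero → e ; (suc x) → ≋-trans (h′ x) (value-weaken (σ x)) })

  value-[] : ∀ {n} {ρ φ : Fin n → V} t {u} → ∣ u ∣ ρ ≋ ∅ →
    value-of t (∅ ◂ ρ) (value-of u ρ φ ◂ φ) ≋ value-of (t [ u ]) ρ φ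
  value-[] t u≋∅ = value-subst t
    (λ { zero → ≋-sym u≋∅ ; (suc x) → ≋-refl })
    (λ { zero → ≋-refl ; (suc x) → ≋-refl })

  value-⟶ : ∀ {n} {ρ φ : Fin n → V} A B → Index (∣ A ∣ ρ) →
            value-of (A ⟶ B) ρ φ ≋ pi (value-of A ρ φ) (single (value-of B ρ φ))
  value-⟶ A B i = pi-cong ≋-refl (image-const {∣ A ∣ _} i λ _ → ≋-sym (value-weaken B))

  -- Values of the simple types and of the constants

  ∣type∣ : ∀ {n} {i p} {ρ : Fin n → V} → ρ i ≋ El one → ρ p ≋ El prop → ∀ A →
           ∣ type i p A ∣ ρ ≋ El ⌊ A ⌋
  ∣type∣ ρi ρp ι = ρi
  ∣type∣ ρi ρp o = ρp
  ∣type∣ {i = i} {p} ρi ρp (A ⇒ B) = ≋-trans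
    (Fun-cong (∣type∣ ρi ρp A)
      (≋-trans (≋-sym (∣∣-weaken (type i p B))) (∣type∣ ρi ρp B)))
    (≋-sym (El-arr ⌊ A ⌋ ⌊ B ⌋))

  single∈𝓐 : (b : Element 𝓑) → 𝓐 (single (value b))
  single∈𝓐 b = full
    (λ z∈ → ∊⇒∈ (∊-respˡ (≋-sym (∊-single (∈⇒∊ {y = single (value b)} z∈)))
                         (∈⇒∊ {y = 𝓑} (value∈ b))))
    (value b , ∊⇒∈ (elem∊ (single (value b)) tt))

  arrow : Element 𝓑 → Element 𝓑 → Element 𝓑
  arrow a b = Π̃ a (single (value b) , single∈𝓐 b)

  ⊤̃≤arrow : ∀ {a b} → ⊤̃ ≤̃ b → ⊤̃ ≤̃ arrow a b
  ⊤̃≤arrow {a} {b} ⊤≤b = Equivalence.from (Π̃-adjoint ⊤̃ a _) λ c (_ , c≈b) →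
    ⊑-trans (maximum _) (⊑-trans ⊤≤b (⊑-reflexive (≐-sym c≈b)))

  pi-arrow : ∀ {x y} a b → x ≋ value a → y ≋ value b → pi x (single y) ≋ value (arrow a b)
  pi-arrow a b x≋ y≋ = ≋-trans (pi-cong x≋ (single-cong y≋)) (pi-value tt _ _)

  -- The value of a simple type. A non-dependent product has a constant family over an inhabited
  -- carrier, hence becomes `Π̃` over a singleton.
  truth : SimpleType → Element 𝓑
  truth ι       = ⊤̃
  truth o       = ⊤̃
  truth (A ⇒ B) = arrow (truth A) (truth B)

  ⊤̃≤truth : ∀ A → ⊤̃ ≤̃ truth A
  ⊤̃≤truth ι       = ⊑-refl
  ⊤̃≤truth o       = ⊑-refl
  ⊤̃≤truth (A ⇒ B) = ⊤̃≤arrow (⊤̃≤truth B)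

  value-type : ∀ {n} {i p} {ρ φ : Fin n → V} → ρ i ≋ El one → ρ p ≋ El prop →
               φ i ≋ value ⊤̃ → φ p ≋ value ⊤̃ → ∀ A →
               value-of (type i p A) ρ φ ≋ value (truth A)
  value-type ρi ρp φi φp ι = φi
  value-type ρi ρp φi φp o = φp
  value-type {i = i} {p} ρi ρp φi φp (A ⇒ B) = ≋-trans
    (value-⟶ (type i p A) (type i p B)
      (position (≋⇒elem∊ (≋-sym (∣type∣ ρi ρp A)) (El-inhabited ⌊ A ⌋))))
    (pi-arrow (truth A) (truth B)
      (value-type ρi ρp φi φp A) (value-type ρi ρp φi φp B))

  typeTruth : Constant → Element 𝓑
  typeTruth iota       = ⊤̃
  typeTruth omicron    = ⊤̃
  typeTruth implies    = truth (o ⇒ o ⇒ o)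
  typeTruth holds      = arrow ⊤̃ ⊤̃
  typeTruth (forAll A) = truth ((A ⇒ o) ⇒ o)

  ⊤̃≤typeTruth : ∀ c → ⊤̃ ≤̃ typeTruth c
  ⊤̃≤typeTruth iota       = ⊑-refl
  ⊤̃≤typeTruth omicron    = ⊑-refl
  ⊤̃≤typeTruth implies    = ⊤̃≤truth (o ⇒ o ⇒ o)
  ⊤̃≤typeTruth holds      = ⊤̃≤arrow ⊑-refl
  ⊤̃≤typeTruth (forAll A) = ⊤̃≤truth ((A ⇒ o) ⇒ o)

  value-typeOf : ∀ {n} {i p} {ρ φ : Fin n → V} → ρ i ≋ El one → ρ p ≋ El prop →
                 φ i ≋ value ⊤̃ → φ p ≋ value ⊤̃ → ∀ c →
                 value-of (typeOf i p c) ρ φ ≋ value (typeTruth c)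
  value-typeOf ρi ρp φi φp iota       = ≋-refl
  value-typeOf ρi ρp φi φp omicron    = ≋-refl
  value-typeOf {ρ = ρ} {φ} ρi ρp φi φp implies =
    value-type {ρ = ρ} {φ} ρi ρp φi φp (o ⇒ o ⇒ o)
  value-typeOf {p = p} {ρ} {φ} ρi ρp φi φp holds = ≋-trans
    (value-⟶ {ρ = ρ} {φ} (var p) (sort Type)
      (position (≋⇒elem∊ (≋-sym ρp) (El-inhabited prop))))
    (pi-arrow ⊤̃ ⊤̃ φp ≋-refl)
  value-typeOf {ρ = ρ} {φ} ρi ρp φi φp (forAll A) =
    value-type {ρ = ρ} {φ} ρi ρp φi φp ((A ⇒ o) ⇒ o)

  constantCarrier : Constant → V
  constantCarrier iota    = El one
  constantCarrier omicron = El prop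
  constantCarrier holds   = El one
  constantCarrier _       = ∅

  -- Dictated by the rewrite rule: since `ε` denotes the identity, this is the value of the
  -- right-hand side, in which `truth A` is the value of the domain. The value of `⇒` below arises
  -- from its rule in the same way.
  quantify : SimpleType → V → V
  quantify A f = pi (value (truth A)) (image (El ⌊ A ⌋) λ i → app f (elem (El ⌊ A ⌋) i))

  constantValue : Constant → V
  constantValue iota       = value ⊤̃
  constantValue omicron    = value ⊤̃
  constantValue implies    = lam 𝓑 λ i → lam 𝓑 λ j → pi (elem 𝓑 i) (single (elem 𝓑 j))
  constantValue holds      = lam 𝓑 (elem 𝓑)
  constantValue (forAll A) = lam (El ⌊ A ⇒ o ⌋) λ i → quantify A (elem (El ⌊ A ⇒ o ⌋) i)

  ⊤̃∊ : value ⊤̃ ∊ 𝓑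
  ⊤̃∊ = ∈⇒∊ (value∈ ⊤̃)

  quantify-cong : ∀ A {f g} → f ≋ g → quantify A f ≋ quantify A g
  quantify-cong A e = pi-cong ≋-refl (image-cong {El ⌊ A ⌋} ≋-refl λ _ _ → app-cong e)

  quantify∊ : ∀ A {f} → f ∊ El ⌊ A ⇒ o ⌋ → quantify A f ∊ 𝓑
  quantify∊ A f∊ = pi∊ (∈⇒∊ (value∈ (truth A)))
    (λ i → app∊ f∊ (elem∊ (El ⌊ A ⌋) i)) (El-inhabited ⌊ A ⌋)

  constantValue∊ : ∀ c → constantValue c ∊ El (typeCode c)
  constantValue∊ iota       = ⊤̃∊
  constantValue∊ omicron    = ⊤̃∊
  constantValue∊ implies    = ∊-Fun⁺
    (λ _ _ e → lam-cong ≋-refl λ _ _ e′ → pi-cong e (single-cong e′))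
    (λ i → ∊-Fun⁺ (λ _ _ e′ → pi-cong ≋-refl (single-cong e′))
      (λ j → pi∊ (elem∊ 𝓑 i) (λ _ → elem∊ 𝓑 j) tt))
  constantValue∊ holds      = ∊-Fun⁺ (λ _ _ e → e) (elem∊ 𝓑)
  constantValue∊ (forAll A) = ∊-Fun⁺ (λ _ _ → quantify-cong A)
    (λ i → quantify∊ A (elem∊ (El ⌊ A ⇒ o ⌋) i))

  app-implies : ∀ {a b} → a ∊ 𝓑 → b ∊ 𝓑 →
                app (app (constantValue implies) a) b ≋ pi a (single b)
  app-implies (at i a≋) (at j b≋) = ≋-trans
    (app-cong (app-lam (λ _ _ e → lam-cong ≋-refl λ _ _ e′ →
      pi-cong e (single-cong e′)) i a≋) ≋-refl)
    (≋-trans (app-lam (λ _ _ e′ → pi-cong ≋-refl (single-cong e′)) j b≋)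
             (≋-sym (pi-cong a≋ (single-cong b≋))))

  app-holds : ∀ {a} → a ∊ 𝓑 → app (constantValue holds) a ≋ a
  app-holds (at i a≋) = ≋-trans (app-lam (λ _ _ e → e) i a≋) (≋-sym a≋)

  app-forAll : ∀ A {f} → f ∊ El ⌊ A ⇒ o ⌋ → app (constantValue (forAll A)) f ≋ quantify A f
  app-forAll A (at i f≋) = ≋-trans
    (app-lam (λ _ _ → quantify-cong A) i f≋) (quantify-cong A (≋-sym f≋))

-- Soundness for typing and for reduction

confluent⇒joinable : ∀ {A : Set} {_⇝_ : Rel A 0ℓ} → ConfluentRel _⇝_ →
                     ∀ {t u} → EqClosure _⇝_ t u →
                     ∃ λ v → Star _⇝_ t v × Star _⇝_ u v
confluent⇒joinable confluent ε = _ , ε , ε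
confluent⇒joinable confluent (fwd r ◅ rs) =
  let v , p , q = confluent⇒joinable confluent rs in v , r ◅ p , q
confluent⇒joinable confluent (bwd r ◅ rs) =
  let v , p , q   = confluent⇒joinable confluent rs
      w , p′ , q′ = confluent (r ◅ ε) p
  in w , p′ , q ◅◅ q′

module Soundness (As : List SimpleType)
                 (confluent : Confluent (simpleTypeTheory As))
                 (subject-reduction : SubjectReduction (simpleTypeTheory As))
                 (B : ΠAlgebra) (full : Full B) where

  open ΠAlgebra B
  open STT As renaming (k to #constants)
  open Constants As
  open Interpret B full

  private
    variable
      Γ : Ext #constants n
      γ : Fin n → Code
      ρ φ : Fin n → V
      D : Term n

  -- The logical relation through which D² factors over erasure: a family denotes the set that its
  -- code names, while an object has the default on both sides.
  Related : Level → Code → V → Set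
  Related obj c v = c ≡ one × v ≋ ∅
  Related fam c v = v ≋ El c

  low-related : {ℓ : Fin n → Level} {l : Level} → (∀ x → Related (ℓ x) (γ x) (ρ x)) →
                Low ℓ l t → Related l (erase t γ) (∣ t ∣ ρ)
  related-under : {ℓ : Fin n → Level} → (∀ x → Related (ℓ x) (γ x) (ρ x)) →
                  ∀ x → Related ((obj ◂ ℓ) x) ((one ◂ γ) x) ((∅ ◂ ρ) x)
  low-related h (var refl) = h _
  low-related {γ = γ} h (Π {A} {B} a b) = ≋-trans
    (Fun-cong (low-related h a) (low-related (related-under h) b))
    (≋-sym (El-arr (erase A γ) (erase B (one ◂ γ))))
  low-related h (ƛ _ t) = low-related (related-under h) t
  low-related h (t · _) = low-related h t
  related-under h zero    = refl , ≋-refl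
  related-under h (suc x) = h x

  kind-related : {ℓ : Fin n → Level} → (∀ x → Related (ℓ x) (γ x) (ρ x)) →
                 IsKind ℓ t → ∣ t ∣ ρ ≋ El (erase t γ)
  kind-related h sort = ≋-refl
  kind-related {γ = γ} h (Π {A} {B} a b) = ≋-trans
    (Fun-cong (low-related h a) (kind-related (related-under h) b))
    (≋-sym (El-arr (erase A γ) (erase B (one ◂ γ))))

  -- A set may have several codes, so a choice `γ` of codes is carried along rather than computed
  -- from `ρ`.
  record CarrierEnv (Γ : Ext #constants n) (γ : Fin n → Code) (ρ : Fin n → V) : Set where
    field
      related          : ∀ x → Related (levels (constants ++ Γ) x) (γ x) (ρ x)
      constant-code    : ∀ c → γ (base Γ c) ≡ constantCode (decode c)
      constant-carrier : ∀ c → ρ (base Γ c) ≋ constantCarrier (decode c)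
      constant-type    : ∀ {c A} → constants ++ Γ ∋ base Γ c ∶ A →
                         erase A γ ≡ typeCode (decode c)

    object-one : ∀ x → levels (constants ++ Γ) x ≡ obj → γ x ≡ one
    object-one x e = proj₁ (subst (λ l → Related l (γ x) (ρ x)) e (related x))

  record ValueEnv (Γ : Ext #constants n) (γ : Fin n → Code) (ρ φ : Fin n → V) : Set where
    field
      carriers       : CarrierEnv Γ γ ρ
      constant-value : ∀ c → φ (base Γ c) ≋ constantValue (decode c)
      var∊           : ∀ {x A} → constants ++ Γ ∋ x ∶ A → φ x ∊ El (erase A γ)

    open CarrierEnv carriers public

  open CarrierEnv using (related; object-one)
  open ValueEnv using (carriers)

  carrier-▹ : ∀ {c ρ} → CarrierEnv Γ γ (ρ ∘ suc) → Related (varLevel A) c (ρ zero) →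
              CarrierEnv (Γ ▹ A) (c ◂ γ) ρ
  carrier-▹ env r = record
    { related          = λ { zero → r ; (suc x) → related env x }
    ; constant-code    = constant-code
    ; constant-carrier = constant-carrier
    ; constant-type    = λ { (there {A = A} x) → trans (sym (erase-weaken A)) (constant-type x) }
    }
    where open CarrierEnv env using (constant-code; constant-carrier; constant-type)

  carrier-bind : CarrierEnv Γ γ ρ → Γ ⊢ C ∶ sort Type → CarrierEnv (Γ ▹ C) (one ◂ γ) (∅ ◂ ρ)
  carrier-bind env C = carrier-▹ env
    (subst (λ l → Related l one ∅) (sym (Low⇒varLevel (Sorted-Type (classify C))))
           (refl , ≋-refl))

  ∣type∣≋El : CarrierEnv Γ γ ρ → Sorted (levels (constants ++ Γ)) t A →
              ∣ A ∣ ρ ≋ El (erase A γ)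
  ∣type∣≋El env (object _ A) = low-related (related env) A
  ∣type∣≋El env (family _ K) = kind-related (related env) K
  ∣type∣≋El env (kind _)     = ≋-refl

  ∣Type∣≋El : CarrierEnv Γ γ ρ → Γ ⊢ C ∶ sort Type → ∣ C ∣ ρ ≋ El (erase C γ)
  ∣Type∣≋El env C = low-related (related env) (Sorted-Type (classify C))

  value-bind : ∀ {v} → ValueEnv Γ γ ρ φ → Γ ⊢ C ∶ sort Type → v ∊ El (erase C γ) →
               ValueEnv (Γ ▹ C) (one ◂ γ) (∅ ◂ ρ) (v ◂ φ)
  value-bind {C = C} {v = v} env C∶ v∊ = record
    { carriers       = carrier-bind (carriers env) C∶
    ; constant-value = ValueEnv.constant-value env
    ; var∊           = λ where
        here              → subst (λ c → v ∊ El c) (erase-weaken C) v∊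
        (there {A = A} x) → subst (λ c → _ ∊ El c) (erase-weaken A) (ValueEnv.var∊ env x)
    }

  erase-step : CarrierEnv Γ γ ρ → Γ ⊢ t ∶ A → t ⟶¹ u → erase t γ ≡ erase u γ
  erase-step {Γ = Γ} env t r with classify t
  ... | object t′ _ = erase-low Γ (object-one env) (CarrierEnv.constant-code env cε) t′ r
  ... | family t′ _ = erase-low Γ (object-one env) (CarrierEnv.constant-code env cε) t′ r
  ... | kind t′     = erase-kind Γ (object-one env) (CarrierEnv.constant-code env cε) t′ r

  erase-steps : CarrierEnv Γ γ ρ → Γ ⊢ t ∶ A → Star _⟶¹_ t u → erase t γ ≡ erase u γ
  erase-steps env t ε        = refl
  erase-steps env t (r ◅ rs) =
    trans (erase-step env t r) (erase-steps env (subject-reduction t r) rs)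

  -- Terms inside a conversion may be ill-typed, and erasure is controlled on typed ones. Confluence
  -- replaces the conversion by two reductions, along which subject reduction keeps typing.
  erase-conv : CarrierEnv Γ γ ρ → Γ ⊢ t ∶ A → Γ ⊢ u ∶ C → t ≡βR u → erase t γ ≡ erase u γ
  erase-conv env t u t≡u =
    let _ , p , q = confluent⇒joinable confluent t≡u
    in trans (erase-steps env t p) (sym (erase-steps env u q))

  erase-argument : CarrierEnv Γ γ ρ → Γ ⊢ t ∶ Π A C → Γ ⊢ u ∶ A → erase u γ ≡ one × ∣ u ∣ ρ ≋ ∅
  erase-argument env t u with classify t
  ... | object _ (Π A _) = low-related (related env) (Sorted-fam A (classify u))
  ... | family _ (Π A _) = low-related (related env) (Sorted-fam A (classify u))

  ∣type∣-inhabited : CarrierEnv Γ γ ρ → Γ ⊢ C ∶ sort Type → Index (∣ C ∣ ρ)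
  ∣type∣-inhabited {C = C} env C∶ =
    position (≋⇒elem∊ (≋-sym (∣Type∣≋El env C∶)) (El-inhabited (erase C _)))

  -- Membership is stated in the set named by the code of the type, so that the conversion rule
  -- becomes an equality of codes.
  value∊ : Γ ⊢ t ∶ A → ValueEnv Γ γ ρ φ → value-of t ρ φ ∊ El (erase A γ)
  body∊ : Γ ⊢ C ∶ sort Type → Γ ▹ C ⊢ t ∶ A → ValueEnv Γ γ ρ φ → ∀ i →
          value-of t (∅ ◂ ρ) (elem (∣ C ∣ ρ) i ◂ φ) ∊ El (erase A (one ◂ γ))
  value∊ (⊢sort _)  env = ⊤̃∊
  value∊ (⊢var _ x) env = ValueEnv.var∊ env x
  value∊ (⊢Π {A = A} s a b) env = pi∊ (value∊ a env) (body∊ a b env)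
    (∣type∣-inhabited (carriers env) a)
  value∊ (⊢ƛ {B = B} {t} s a b t∶) env = ∊-respʳ
    (≋-trans (Fun-cong (∣Type∣≋El (carriers env) a) ≋-refl) (≋-sym (El-arr _ (erase B _))))
    (∊-Fun⁺ (λ _ _ → value-cong-◂ t) (body∊ a t∶ env))
  value∊ (⊢app {B = B} t u) env = subst (λ c → _ ∊ El c)
    (erase-[] B (proj₁ (erase-argument (carriers env) t u)))
    (app∊ (∊-respʳ (El-arr _ (erase B _)) (value∊ t env)) (value∊ u env))
  value∊ (⊢conv s a b t a≡b) env =
    subst (λ c → _ ∊ El c) (erase-conv (carriers env) a b a≡b) (value∊ t env)
  body∊ {C = C} {ρ = ρ} C∶ t∶ env i = value∊ t∶
    (value-bind env C∶ (∊-respʳ (∣Type∣≋El (carriers env) C∶) (elem∊ (∣ C ∣ ρ) i)))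

  -- This and the inversions of abstraction and application relate types by equality of codes only;
  -- that much suffices to place values in sets.
  inverse-var : ∀ {x} → CarrierEnv Γ γ ρ → Γ ⊢ var x ∶ A →
                ∃ λ C → (constants ++ Γ ∋ x ∶ C) × erase A γ ≡ erase C γ
  inverse-var env (⊢var _ x) = _ , x , refl
  inverse-var env (⊢conv _ a b t a≡b) =
    let C , x , e = inverse-var env t in C , x , trans (sym (erase-conv env a b a≡b)) e

  inverse-Π : Γ ⊢ Π C D ∶ A → (Γ ⊢ C ∶ sort Type) × ∃ λ s → Γ ▹ C ⊢ D ∶ sort s
  inverse-Π (⊢Π s C D)        = C , s , D
  inverse-Π (⊢conv _ _ _ t _) = inverse-Π t

  inverse-ƛ : CarrierEnv Γ γ ρ → Γ ⊢ ƛ C t ∶ A →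
              (Γ ⊢ C ∶ sort Type) × ∃ λ D → (Γ ▹ C ⊢ t ∶ D) × erase A γ ≡ erase (Π C D) γ
  inverse-ƛ env (⊢ƛ _ C _ t) = C , _ , t , refl
  inverse-ƛ env (⊢conv _ a b t a≡b) =
    let C , D , t′ , e = inverse-ƛ env t
    in C , D , t′ , trans (sym (erase-conv env a b a≡b)) e

  inverse-app : CarrierEnv Γ γ ρ → Γ ⊢ t · u ∶ A →
                ∃ λ C → ∃ λ D → (Γ ⊢ t ∶ Π C D) × (Γ ⊢ u ∶ C) ×
                erase A γ ≡ erase D (one ◂ γ)
  inverse-app env (⊢app {B = D} t u) =
    _ , D , t , u , sym (erase-[] D (proj₁ (erase-argument env t u)))
  inverse-app env (⊢conv _ a b t a≡b) =
    let C , D , t′ , u′ , e = inverse-app env t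
    in C , D , t′ , u′ , trans (sym (erase-conv env a b a≡b)) e

  constant-code-type : ∀ {c d} → CarrierEnv Γ γ ρ → t ≡ var (base Γ c) → decode c ≡ d →
                       Γ ⊢ t ∶ A → erase A γ ≡ typeCode d
  constant-code-type env refl refl t =
    let _ , x , e = inverse-var env t in trans e (CarrierEnv.constant-type env x)

  constant-value-of : ∀ {c d} → ValueEnv Γ γ ρ φ → t ≡ var (base Γ c) → decode c ≡ d →
                      value-of t ρ φ ≋ constantValue d
  constant-value-of env refl refl = ValueEnv.constant-value env _

  constant-carrier-of : ∀ {c d} → CarrierEnv Γ γ ρ → t ≡ var (base Γ c) → decode c ≡ d →
                        ∣ t ∣ ρ ≋ constantCarrier d
  constant-carrier-of env refl refl = CarrierEnv.constant-carrier env _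

  value-root : Γ ⊢ t ∶ A → ValueEnv Γ γ ρ φ → Root Rules t u →
               value-of t ρ φ ≋ value-of u ρ φ
  value-root {Γ = Γ} {γ = γ} {ρ} {φ} t∶ env (fire implication Δ θ θ≡) =
    let _ , _ , ε∶ , ⇒xy∶ , _   = inverse-app cenv t∶
        C₁ , D₁ , ⇒x∶ , y∶ , e₁ = inverse-app cenv ⇒xy∶
        C₂ , D₂ , ⇒∶ , x∶ , e₂  = inverse-app cenv ⇒x∶
        -- The declared type of `⇒` has code `fun prop (fun prop prop)`. Since no codomain in it is
        -- `one`, `arr` can be inverted, which puts the values of both arguments in `𝓑`.
        C₂≡ , D₂≡ = arr≡fun (erase D₂ _) (constant-code-type cenv (θ-base c⇒) decode-⇒ ⇒∶)
        C₁≡ , _   = arr≡fun (erase D₁ _) (trans e₂ D₂≡)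
        x∊ = subst (λ c → _ ∊ El c) C₂≡ (value∊ x∶ env)
        y∊ = subst (λ c → _ ∊ El c) C₁≡ (value∊ y∶ env)
        ⟦⇒xy⟧ = ≋-trans (app-cong (app-cong
                  (constant-value-of env (θ-base c⇒) decode-⇒) ≋-refl) ≋-refl)
                  (app-implies x∊ y∊)
    in ≋-trans (app-cong ⟦ε⟧ ⟦⇒xy⟧)
         (≋-trans (app-holds (pi∊ x∊ (λ _ → y∊) tt))
         (≋-sym (≋-trans
           (value-⟶ (θ 2F · θ 1F) (θ 2F · θ 0F) (position (≋⇒elem∊ (≋-sym ∣ε∣) tt)))
           (pi-cong (≋-trans (app-cong ⟦ε⟧ ≋-refl) (app-holds x∊))
             (single-cong (≋-trans (app-cong ⟦ε⟧ ≋-refl) (app-holds y∊)))))))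
    where
    cenv = carriers env
    θ-base : ∀ c → θ (suc (suc c)) ≡ var (base Γ c)
    θ-base c = trans (θ≡ c) (cong var (base-unique Δ Γ c))
    ⟦ε⟧ : value-of (θ 2F) ρ φ ≋ constantValue holds
    ⟦ε⟧ = constant-value-of env (θ-base cε) refl
    ∣ε∣ : ∣ θ 2F ∣ ρ ≋ El one
    ∣ε∣ = constant-carrier-of cenv (θ-base cε) refl
  value-root {Γ = Γ} {γ = γ} {ρ} {φ} t∶ env (fire (universal {A} A∈) Δ θ θ≡) =
    let _ , _ , ε∶ , ∀x∶ , _ = inverse-app cenv t∶
        C , D , ∀∶ , x∶ , _  = inverse-app cenv ∀x∶
        C≡ , _ = arr≡fun (erase D _) (constant-code-type cenv (θ-base (c∀ A∈)) (decode-∀ A∈) ∀∶)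
        x∊ = subst (λ c → _ ∊ El c) C≡ (value∊ x∶ env)
        ⟦∀x⟧ = ≋-trans (app-cong (constant-value-of env (θ-base (c∀ A∈)) (decode-∀ A∈)) ≋-refl)
                 (app-forAll A x∊)
    in ≋-trans (app-cong ⟦ε⟧ ⟦∀x⟧)
         (≋-trans (app-holds (quantify∊ A x∊))
         (pi-cong
           -- The domain is the simple type instantiated by `θ`: it is evaluated in the rule
           -- context, with each variable read as the value of its image under `θ`, and then
           -- transported by substitution.
           (≋-trans (≋-sym (value-type (constant-carrier-of cenv (θ-base cι) decode-ι)
                                       (constant-carrier-of cenv (θ-base co) decode-o)
                                       (constant-value-of env (θ-base cι) decode-ι)
                                       (constant-value-of env (θ-base co) decode-o) A))
                    (value-subst (type (suc cι) (suc co) A) (λ _ → ≋-refl) (λ _ → ≋-refl)))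
           (image-cong
             (≋-trans (≋-sym (∣type∣ (constant-carrier-of cenv (θ-base cι) decode-ι)
                                     (constant-carrier-of cenv (θ-base co) decode-o) A))
                      (∣∣-subst (type (suc cι) (suc co) A) λ _ → ≋-refl))
             λ i j e → ≋-sym (≋-trans
               (app-cong (≋-trans (≋-sym (value-weaken (θ 1F))) ⟦ε⟧)
                         (app-cong (≋-sym (value-weaken (θ 0F))) (≋-sym e)))
               (app-holds (app∊ x∊ (elem∊ (El ⌊ A ⌋) i)))))))
    where
    cenv = carriers env
    θ-base : ∀ c → θ (suc c) ≡ var (base Γ c)
    θ-base c = trans (θ≡ c) (cong var (base-unique Δ Γ c))
    ⟦ε⟧ : value-of (θ 1F) ρ φ ≋ constantValue holds
    ⟦ε⟧ = constant-value-of env (θ-base cε) refl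

  Type-step : Γ ⊢ C ∶ sort Type → CarrierEnv Γ γ ρ → C ⟶¹ D → ∣ C ∣ ρ ≋ ∣ D ∣ ρ
  Type-step C env r = ≋-trans (∣Type∣≋El env C)
    (≋-trans (≋-reflexive (cong El (erase-step env C r)))
             (≋-sym (∣Type∣≋El env (subject-reduction C r))))

  -- When the codomain is one, the redex and its contractum, which are both
  -- typed, are ∅; otherwise the domain of the abstraction is determined.

  value-β : Γ ⊢ ƛ C t ∶ Π A D → Γ ⊢ u ∶ A → ValueEnv Γ γ ρ φ →
            value-of (ƛ C t · u) ρ φ ≋ value-of (t [ u ]) ρ φ
  value-β {C = C} {t = t} {D = D} {u = u} {γ = γ} {ρ} {φ} f∶ u∶ env
    with inverse-ƛ (carriers env) f∶
  ... | C∶ , E , t∶ , e with arr-injective (erase D _) _ e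
  ...   | inj₁ D≡one = ≋-trans (∊-single (∊One redex)) (≋-sym (∊-single
            (∊One (subject-reduction redex (root (inj₁ beta))))))
    where
    redex = ⊢app f∶ u∶
    ∊One : ∀ {s} → _ ⊢ s ∶ D [ u ] → value-of s ρ φ ∊ El one
    ∊One {s} s∶ = subst (λ c → value-of s ρ φ ∊ El c)
      (trans (sym (erase-[] D (proj₁ (erase-argument (carriers env) f∶ u∶)))) D≡one)
      (value∊ s∶ env)
  ...   | inj₂ (A≡C , _) =
    let at i u≋ = ∊-respʳ
          (≋-trans (≋-reflexive (cong El A≡C)) (≋-sym (∣Type∣≋El (carriers env) C∶)))
          (value∊ u∶ env)
    in ≋-trans (app-lam (λ _ _ → value-cong-◂ t) i u≋)
         (≋-trans (value-cong-◂ t (≋-sym u≋))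
                  (value-[] t (proj₂ (erase-argument (carriers env) f∶ u∶))))

  -- The induction is on the derivation and passes through conversions, as the claim does not
  -- mention the type. Typing provides the membership facts without which a redex might evaluate to
  -- junk.
  value-step : Γ ⊢ t ∶ A → ValueEnv Γ γ ρ φ → t ⟶¹ u → value-of t ρ φ ≋ value-of u ρ φ
  body-step : Γ ⊢ C ∶ sort Type → Γ ▹ C ⊢ t ∶ A → ValueEnv Γ γ ρ φ → t ⟶¹ u →
              ∀ i j → elem (∣ C ∣ ρ) i ≋ elem (∣ C ∣ ρ) j →
              value-of t (∅ ◂ ρ) (elem (∣ C ∣ ρ) i ◂ φ) ≋
              value-of u (∅ ◂ ρ) (elem (∣ C ∣ ρ) j ◂ φ)
  value-step t∶ env (root (inj₂ r)) = value-root t∶ env r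
  value-step (⊢conv _ _ _ t _) env r = value-step t env r
  value-step (⊢app t u) env (root (inj₁ beta)) = value-β t u env
  value-step (⊢Π {B = E} _ c e) env (Πˡ r) = pi-cong (value-step c env r)
    (image-cong (Type-step c (carriers env) r) λ _ _ → value-cong-◂ E)
  value-step {ρ = ρ} (⊢Π {A = C} _ c e) env (Πʳ r) =
    pi-cong ≋-refl (image-cong {∣ C ∣ ρ} ≋-refl (body-step c e env r))
  value-step (⊢ƛ {t = t} _ c _ _) env (ƛˡ r) =
    lam-cong (Type-step c (carriers env) r) λ _ _ → value-cong-◂ t
  value-step (⊢ƛ _ c _ t) env (ƛʳ r) = lam-cong ≋-refl (body-step c t env r)
  value-step (⊢app t u) env (appˡ r) = app-cong (value-step t env r) ≋-refl
  value-step (⊢app t u) env (appʳ r) = app-cong ≋-refl (value-step u env r)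
  body-step {C = C} {ρ = ρ} {u = u} C∶ t∶ env r i j e = ≋-trans
    (value-step t∶
      (value-bind env C∶ (∊-respʳ (∣Type∣≋El (carriers env) C∶) (elem∊ (∣ C ∣ ρ) i))) r)
    (value-cong-◂ u e)

  subject-reduction* : Γ ⊢ t ∶ A → Star _⟶¹_ t u → Γ ⊢ u ∶ A
  subject-reduction* t ε        = t
  subject-reduction* t (r ◅ rs) = subject-reduction* (subject-reduction t r) rs

  value-steps : Γ ⊢ t ∶ A → ValueEnv Γ γ ρ φ → Star _⟶¹_ t u →
                value-of t ρ φ ≋ value-of u ρ φ
  value-steps t env ε        = ≋-refl
  value-steps t env (r ◅ rs) =
    ≋-trans (value-step t env r) (value-steps (subject-reduction t r) env rs)

-- The model

withConstants-rename : ∀ {k m n} {Γ : Ext k m} {Δ : Ext k n} {f : Fin m → Fin n} →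
  Injective _≡_ _≡_ f → (∀ c → f (base Γ c) ≡ base Δ c) →
  ∀ v φ ψ {P : Fin m → Set} → (∀ {x A} → Γ ∋ x ∶ A → P x → φ x ≐ ψ (f x)) →
  ∀ x → P x → withConstants v φ x ≋ withConstants v ψ (f x)
withConstants-rename {Γ = Γ} {Δ} {f} f-inj f-base v φ ψ φ≐ψ x p with base⊎∋ Γ x
... | inj₁ (c , refl) = ≋-reflexive (trans (withConstants-base v φ Γ c)
        (sym (trans (cong (withConstants v ψ) (f-base c)) (withConstants-base v ψ Δ c))))
... | inj₂ (_ , ∋x) with base⊎∋ Δ (f x)
-- By injectivity, a renaming that fixes the constants cannot send a declared variable to one of
-- them.
...   | inj₁ (c , e)    = ⊥-elim
          (∌base (subst (λ y → Γ ∋ y ∶ _) (f-inj (trans e (sym (f-base c)))) ∋x))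
...   | inj₂ (_ , ∋fx) = ≋-trans (≋-reflexive (withConstants-∋ v φ ∋x))
          (≋-trans (equal (φ≐ψ ∋x p)) (≋-reflexive (sym (withConstants-∋ v ψ ∋fx))))

-- The reading `I` of terms is arbitrary so that one argument serves D² and D³ alike.
withConstants-insertAt : ∀ {k n} {Γ : Ext k (suc n)} {x A u} v φ → Γ ∋ x ∶ A →
  (I : Term n → V) → (∀ z → I (var z) ≡ withConstants v φ z) →
  ∀ y → withConstants v (insertAt φ x (I u)) y ≡ I (insertAt var x u y)
withConstants-insertAt {x = x} {u = u} v φ ∋x I I-var y with x ≟ y
... | yes refl = trans (withConstants-∋ v (insertAt φ x (I u)) ∋x)
  (trans (insertAt-lookup φ x (I u)) (cong I (sym (insertAt-lookup var x u))))
... | no x≢y = subst (λ y → withConstants v (insertAt φ x (I u)) y ≡ I (insertAt var x u y))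
  (punchIn-punchOut x≢y)
  (trans (cong₂ (maybe′ v) (insertAt-punchIn φ x (I u) z) (constant?-punchIn x (∋⇒< ∋x) z))
  (trans (sym (I-var z)) (cong I (sym (insertAt-punchIn var x u z)))))
  where z = punchOut x≢y

withConstants-◂ : ∀ {k n} (Γ : Ext k n) (v : Fin k → V) (φ : Valuation n) {a b} → a ≋ b → ∀ x →
  withConstants v (insertAt φ zero a) x ≋ (b ◂ withConstants v φ) x
withConstants-◂ Γ v φ a≋b zero    = ≋-trans
  -- `sort Type` is a dummy declaration: only the position of the variable shows that it is not a
  -- constant.
  (≋-reflexive (withConstants-∋ v (insertAt φ zero _) (here {Γ = Γ} {A = sort Type}))) a≋b
withConstants-◂ Γ v φ a≋b (suc x) = ≋-refl

module Construction (As : List SimpleType)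
                    (confluent : Confluent (simpleTypeTheory As))
                    (subject-reduction : SubjectReduction (simpleTypeTheory As))
                    (B : ΠAlgebra) (full : Full B) where

  open ΠAlgebra B hiding (_≤_)
  open IsPreorder isPreorder using () renaming (trans to ⊑-trans; reflexive to ⊑-reflexive)
  open STT As using (constants; Rules; cι; co) renaming (k to #constants)
  open Constants As
  open Interpret B full
  open Soundness As confluent subject-reduction B full

  universe : Level → V
  universe obj = single ∅
  universe fam = sup Code El

  carriers₀ values₀ : Fin #constants → V
  carriers₀ = constantCarrier ∘ decode
  values₀ = constantValue ∘ decode

  carriers-of values-of : ∀ {n} → Valuation n → Fin n → V
  carriers-of = withConstants carriers₀
  values-of   = withConstants values₀

  D : Interpretation
  D 0 t _                   = universe (varLevel t)
  D 1 t (φ ∷ [])            = ∣ t ∣ (carriers-of φ)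
  D 2 t (ψ ∷ φ ∷ [])        = value-of t (carriers-of φ) (values-of ψ)
  D (suc (suc (suc _))) _ _ = ∅

  Related⇒∊ : ∀ l c {v} → Related l c v → v ∊ universe l
  Related⇒∊ obj _ (_ , e) = at tt e
  Related⇒∊ fam c e       = at c e

  ∊⇒Related : ∀ l {v} → v ∊ universe l → ∃ λ c → Related l c v
  ∊⇒Related obj (at _ e) = one , refl , e
  ∊⇒Related fam (at c e) = c , e

  constant-related : ∀ {n} {i p : Fin n} c →
    Related (varLevel (typeOf i p c)) (constantCode c) (constantCarrier c)
  constant-related iota       = ≋-refl
  constant-related omicron    = ≋-refl
  constant-related implies    = refl , ≋-refl
  constant-related holds      = ≋-refl
  constant-related (forAll _) = refl , ≋-refl

  constants-env : {φ : Valuation #constants} →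
                  CarrierEnv [] (constantCode ∘ decode) (carriers-of φ)
  constants-env {φ} = record
    { related          = λ x →
        let A , ∋x = declared constants x
            level  = trans (levels-∋ ∋x) (cong varLevel (decode-type ∋x))
        in subst (λ l → Related l (constantCode (decode x)) (carriers-of φ x)) (sym level)
             (subst (Related (varLevel (typeOf cι co (decode x))) _)
                    (sym (withConstants-base carriers₀ φ [] x)) (constant-related (decode x)))
    ; constant-code    = λ _ → refl
    ; constant-carrier = λ c → ≋-reflexive (withConstants-base carriers₀ φ [] c)
    ; constant-type    = λ {c} ∋c → trans
        (cong (λ A → erase A (constantCode ∘ decode)) (decode-type ∋c))
        (erase-typeOf {i = cι} {co} (cong constantCode decode-ι) (cong constantCode decode-o)
                      (decode c))
    }

  -- Validity puts each D²-value in a universe, where it comes with a code; these codes are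
  -- collected along the context.
  carrier-env : ∀ {n} {Γ : Ext #constants n} {φ} → ⊢ Γ → Valid D Γ (φ ∷ []) →
                ∃ λ γ → CarrierEnv Γ γ (carriers-of φ)
  carrier-env empty _ = _ , constants-env
  carrier-env {φ = φ} (declare {Γ = Γ} {A} _ A∶) (_ , valid) =
    let _ , env = carrier-env (⊢-context A∶) (tt , λ {x} {C} ∋x →
                    subst (λ l → φ (suc x) ∈ universe l) (varLevel-rename C) (valid (there ∋x)))
        _ , r   = ∊⇒Related (varLevel A) (∈⇒∊ (subst (λ l → φ zero ∈ universe l)
                    (varLevel-rename A) (valid here)))
    in _ , carrier-▹ env
         (subst (Related (varLevel A) _) (sym (withConstants-∋ carriers₀ φ (here {Γ = Γ} {A}))) r)

  value-env : ∀ {n} {Γ : Ext #constants n} {γ φ ψ} → CarrierEnv Γ γ (carriers-of φ) →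
              ⊢ Γ → Valid D Γ (ψ ∷ φ ∷ []) → ValueEnv Γ γ (carriers-of φ) (values-of ψ)
  value-env {Γ = Γ} {γ} {φ} {ψ} env ⊢Γ (_ , valid) = record
    { carriers       = env
    ; constant-value = λ c → ≋-reflexive (withConstants-base values₀ ψ Γ c)
    ; var∊           = var∊
    }
    where
    var∊ : ∀ {x A} → constants ++ Γ ∋ x ∶ A → values-of ψ x ∊ El (erase A γ)
    var∊ {x} {A} ∋x with ∋⇒base⊎∋ {Γ = Γ} ∋x
    ... | inj₁ (c , refl) = subst (λ a → values-of ψ x ∊ El a)
          (sym (CarrierEnv.constant-type env ∋x))
          (∊-respˡ (≋-reflexive (sym (withConstants-base values₀ ψ Γ c)))
                   (constantValue∊ (decode c)))
    ... | inj₂ ∋x′ = ∊-respˡ (≋-reflexive (sym (withConstants-∋ values₀ ψ ∋x′)))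
          (∊-respʳ (∣type∣≋El env (⊢⇒Classified ⊢Γ ∋x))
                   (∈⇒∊ {y = ∣ A ∣ (carriers-of φ)} (valid ∋x′)))

  environment : ∀ {n} {Γ : Ext #constants n} {φ ψ t A} → Γ ⊢ t ∶ A → Valid D Γ (ψ ∷ φ ∷ []) →
                ∃ λ γ → ValueEnv Γ γ (carriers-of φ) (values-of ψ)
  environment t (valid₁ , valid₂) =
    let ⊢Γ = ⊢-context t
        γ , env = carrier-env ⊢Γ valid₁
    in γ , value-env env ⊢Γ (valid₁ , valid₂)

  carrier∊ : ∀ {n} {Γ : Ext #constants n} {γ ρ t A} → CarrierEnv Γ γ ρ →
             Sorted (levels (constants ++ Γ)) t A → ∣ t ∣ ρ ∊ universe (varLevel A)
  carrier∊ {γ = γ} {t = t} env (object t∶ A) =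
    subst (λ l → _ ∊ universe l) (sym (Low⇒varLevel A))
    (Related⇒∊ obj (erase t γ) (low-related (CarrierEnv.related env) t∶))
  carrier∊ {γ = γ} {t = t} env (family t∶ K) =
    subst (λ l → _ ∊ universe l) (sym (IsKind⇒varLevel K))
    (Related⇒∊ fam (erase t γ) (low-related (CarrierEnv.related env) t∶))
  carrier∊ {γ = γ} {t = t} env (kind K) = at (erase t γ) (kind-related (CarrierEnv.related env) K)

  carrier-convert : ∀ {n} {Γ : Ext #constants n} {γ ρ t u A} → CarrierEnv Γ γ ρ →
    Sorted (levels (constants ++ Γ)) t A → Sorted (levels (constants ++ Γ)) u A →
    erase t γ ≡ erase u γ → ∣ t ∣ ρ ≋ ∣ u ∣ ρ
  carrier-convert {ρ = ρ} env t u e = go t u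
    where
    r = CarrierEnv.related env
    El≋ = ≋-reflexive (cong El e)
    go : Sorted _ _ _ → Sorted _ _ _ → _
    go (object t _) (object u _) =
      ≋-trans (proj₂ (low-related r t)) (≋-sym (proj₂ (low-related r u)))
    go (object _ A) (family _ K) = ⊥-elim (Low⇒¬IsKind A K)
    go (object _ ()) (kind _)
    go (family _ K) (object _ A) = ⊥-elim (Low⇒¬IsKind A K)
    go (family t _) (family u _) =
      ≋-trans (low-related r t) (≋-trans El≋ (≋-sym (low-related r u)))
    go (family _ ()) (kind _)
    go (kind _) (object _ ())
    go (kind _) (family _ ())
    go (kind t) (kind u) =
      ≋-trans (kind-related r t) (≋-trans El≋ (≋-sym (kind-related r u)))

  D-steps : ∀ {n} {Γ : Ext #constants n} {t u A j} → j < 3 → Γ ⊢ t ∶ A → Star _⟶¹_ t u →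
            (φs : Vec (Valuation n) j) → Valid D Γ φs → D j t φs ≋ D j u φs
  -- D¹ sees only whether a term is a kind, and the common type of the term and its reduct settles
  -- this.
  D-steps {j = 0} _ t rs [] _ = ≋-reflexive (cong universe
    (Sorted-varLevel (classify t) (classify (subject-reduction* t rs))))
  D-steps {j = 1} _ t rs (φ ∷ []) valid =
    let _ , env = carrier-env (⊢-context t) valid
    in carrier-convert env (classify t) (classify (subject-reduction* t rs)) (erase-steps env t rs)
  D-steps {j = 2} _ t rs (ψ ∷ φ ∷ []) valid = value-steps t (proj₂ (environment t valid)) rs
  D-steps {j = suc (suc (suc _))} (s≤s (s≤s (s≤s ())))

  D-member : ∀ {j n} {Γ : Ext #constants n} {t A} → suc j < 3 → Γ ⊢ t ∶ A →
    (φ : Valuation n) (φs : Vec (Valuation n) j) → Valid D Γ (φ ∷ φs) →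
    D (suc j) t (φ ∷ φs) ∊ D j A φs
  D-member {0} _ t φ [] valid = carrier∊ (proj₂ (carrier-env (⊢-context t) valid)) (classify t)
  D-member {1} _ t ψ (φ ∷ []) valid =
    let _ , env = environment t valid
    in ∊-respʳ (≋-sym (∣type∣≋El (ValueEnv.carriers env) (classify t))) (value∊ t env)
  D-member {suc (suc _)} (s≤s (s≤s (s≤s ())))

  D-rename : ∀ {m n} {Γ : Ext #constants m} {Δ : Ext #constants n}
    (ρ : Fin m → Fin n) → Injective _≡_ _≡_ ρ → (∀ c → ρ (base Γ c) ≡ base Δ c) →
    ∀ {t j} (φs : Vec (Valuation m) j) (ψs : Vec (Valuation n) j) →
    Pointwise (λ φ ψ → ∀ {x A} → Γ ∋ x ∶ A → x FreeIn t → φ x ≐ ψ (ρ x)) φs ψs →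
    D j t φs ≋ D j (rename ρ t) ψs
  D-rename ρ inj fixes {t} [] [] [] = ≋-reflexive (cong universe (sym (varLevel-rename t)))
  D-rename ρ inj fixes {t} (φ ∷ []) (φ′ ∷ []) (p ∷ []) =
    ∣∣-rename t (withConstants-rename inj fixes carriers₀ φ φ′ p)
  D-rename ρ inj fixes {t} (ψ ∷ φ ∷ []) (ψ′ ∷ φ′ ∷ []) (q ∷ p ∷ []) =
    value-rename t (withConstants-rename inj fixes carriers₀ φ φ′ p)
                   (withConstants-rename inj fixes values₀ ψ ψ′ q)
  D-rename ρ inj fixes (_ ∷ _ ∷ _ ∷ _) (_ ∷ _ ∷ _ ∷ _) _ = ≋-refl

  D-substitution : ∀ {n} {Γ : Ext #constants (suc n)} {x A t u} → Γ ∋ x ∶ A →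
    (φs : Vec (Valuation n) 2) → D 2 (t [ x ≔ u ]) φs ≋ D 2 t (assign D x u φs)
  D-substitution {t = t} ∋x (ψ ∷ φ ∷ []) = ≋-sym (value-subst t
    (λ y → ≋-reflexive (withConstants-insertAt carriers₀ φ ∋x
      (λ s → ∣ s ∣ (carriers-of φ)) (λ _ → refl) y))
    (λ y → ≋-reflexive (withConstants-insertAt values₀ ψ ∋x
      (λ s → value-of s (carriers-of φ) (values-of ψ)) (λ _ → refl) y)))

  universe-inhabited : ∀ l → Index (universe l)
  universe-inhabited obj = tt
  universe-inhabited fam = one

  module _ {n} {Γ : Ext #constants n} {C E A} (ψ φ : Valuation n)
           (⊢ΠCE : Γ ⊢ Π C E ∶ A) (valid : Valid D Γ (ψ ∷ φ ∷ [])) where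

    private
      ρ = carriers-of φ
      C∶ = proj₁ (inverse-Π ⊢ΠCE)
      E∶ = proj₂ (proj₂ (inverse-Π ⊢ΠCE))
      env = proj₂ (environment ⊢ΠCE valid)
      i₀ = ∣type∣-inhabited (ValueEnv.carriers env) C∶

    -- The domain `C` is a type, so its D¹-value is `{ ∅ }`: the first component of a tuple is
    -- always `∅`, the default at binders, and only the second one varies.
    range≋image : range D C E (ψ ∷ φ ∷ []) ≋
      image (∣ C ∣ ρ) (λ i → value-of E (∅ ◂ ρ) (elem (∣ C ∣ ρ) i ◂ values-of ψ))
    range≋image = ≋-ext
      (λ ((_ , c) , i) → at i (value≋ c i))
      (λ i → at ((tt , universe-inhabited (varLevel C)) , i) (≋-sym (value≋ _ i)))
      where
      value≋ : ∀ c i → value-of E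
        (carriers-of (insertAt φ zero (elem (universe (varLevel C)) c)))
        (values-of (insertAt ψ zero (elem (∣ C ∣ ρ) i))) ≋
        value-of E (∅ ◂ ρ) (elem (∣ C ∣ ρ) i ◂ values-of ψ)
      value≋ c i = value-cong E
        (withConstants-◂ Γ carriers₀ φ (∊-single (subst
          (λ l → elem (universe (varLevel C)) c ∊ universe l)
          (Low⇒varLevel (Sorted-Type (classify C∶))) (elem∊ _ c))))
        (withConstants-◂ Γ values₀ ψ ≋-refl)

    D-product : ∃ λ (c∈ : D 2 C (ψ ∷ φ ∷ []) ∈ 𝓑) → ∃ λ (S∈ : 𝓐 (range D C E (ψ ∷ φ ∷ []))) →
      D 2 (Π C E) (ψ ∷ φ ∷ []) ≐
      value (Π̃ ⟨ D 2 C (ψ ∷ φ ∷ []) , c∈ ⟩ (range D C E (ψ ∷ φ ∷ []) , S∈))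
    D-product = c∈ , S∈ , ≋⇒≐ (≋-trans (pi-cong ≋-refl (≋-sym range≋image)) (pi-value i₁ c∈ S∈))
      where
      c∈ = ∊⇒∈ (value∊ C∶ env)
      i₁ = (tt , universe-inhabited (varLevel C)) , i₀
      S∊ : ∀ i → elem (range D C E (ψ ∷ φ ∷ [])) i ∊ 𝓑
      S∊ i = let at j e = ≋⇒elem∊ range≋image i in ∊-respˡ (≋-sym e) (body∊ C∶ E∶ env j)
      S∈ = full
        (λ z∈ → let at i e = ∈⇒∊ {y = range D C E (ψ ∷ φ ∷ [])} z∈ in
          ∊⇒∈ (∊-respˡ (≋-sym e) (S∊ i)))
        (_ , ∊⇒∈ (elem∊ (range D C E (ψ ∷ φ ∷ [])) i₁))

  D-constant : ∀ {c A} → constants ∋ c ∶ A → (φs : Vec (Valuation #constants) 2) →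
               D 2 A φs ≋ value (typeTruth (decode c))
  D-constant {c} ∋c (ψ ∷ φ ∷ []) rewrite decode-type ∋c = value-typeOf {i = cι} {co}
    (constant constantCarrier φ decode-ι) (constant constantCarrier φ decode-o)
    (constant constantValue ψ decode-ι) (constant constantValue ψ decode-o) (decode c)
    where
    constant : ∀ (v : Constant → V) φ {c d} → decode c ≡ d →
               withConstants (v ∘ decode) φ c ≋ v d
    constant v φ {c} refl = ≋-reflexive (withConstants-base (v ∘ decode) φ [] c)

  model : Model (simpleTypeTheory As) B
  model = record
    { r             = 1
    ; D             = D
    ; member        = λ j< t φ φs valid → ∊⇒∈ (D-member j< t φ φs valid)
    ; depends       = λ ρ inj fixes _ _ _ φs ψs _ _ p → ≋⇒≐ (D-rename ρ inj fixes φs ψs p)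
    ; substitution  = λ {t = t} ∋x _ _ _ φs _ _ → ≋⇒≐ (D-substitution {t = t} ∋x φs)
    ; carrier       = λ { _ (_ ∷ []) _ _ → ≐-refl 𝓑 }
    ; sort-value    = λ { _ (_ ∷ _ ∷ []) _ _ → ≐-refl (value ⊤̃) }
    ; product-value = λ { (ψ ∷ φ ∷ []) → D-product ψ φ }
    ; constants     = λ {c} ∋c φs _ →
        let e = D-constant ∋c φs ; T = typeTruth (decode c)
        in ∊⇒∈ (∊-respˡ (≋-sym e) (∈⇒∊ {y = 𝓑} (value∈ T))) ,
           ⊑-trans (⊤̃≤typeTruth (decode c)) (⊑-reflexive (≋⇒≐ (≋-sym e)))
    ; congruence    = λ j< t u t≡u φs valid →
        let _ , p , q = confluent⇒joinable confluent t≡u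
        in ≋⇒≐ (≋-trans (D-steps j< t p φs valid) (≋-sym (D-steps j< u q φs valid)))
    }

theorem4p1 : (As : List SimpleType) → Unique As →
    Confluent (simpleTypeTheory As) → SubjectReduction (simpleTypeTheory As) →
    SuperConsistent (simpleTypeTheory As)
theorem4p1 As _ confluent subject-reduction B full _ _ =
  Construction.model As confluent subject-reduction B full
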